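{- The problem $1||er+\sum w_jC_j$ (given jobs $J$ with processing times $p_j$ and weights $w_j$, a subset $J^r\subseteq J$ and a unit rental cost $\lambda\ge 0$, find a sequence of $J$ minimizing $\sum_{j\in J}w_jC_j+\lambda\cdot er$, where $er$ is the length of the renting period) can be solved in $\mathrm{O}(n\log n)$ time, where $n=|J|$.
   Context: An instance has a finite set $J$ of $n$ jobs; job $j$ has a positive integer processing time $p_j$ and a non-negative integer weight $w_j$. A non-empty subset $J^r\subseteq J$ (the r-jobs) requires an external resource. A sequence is a permutation of $J$; the jobs are processed one at a time on a single machine in this order, non-preemptively, from time $0$ without idle time. $C_j$ is the completion time of job $j$. The resource is rented once, without interruption, from the start of the first r-job to the completion of the last r-job, so $er=\max_{j\in J^r} C_j-\min_{j\in J^r}(C_j-p_j)$. Running times count elementary (unit-cost) arithmetic operations and comparisons. -}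

module Defs where

open import Algebra.Bundles using (CommutativeRing)
open import Data.Bool.Base using (if_then_else_)
open import Data.Fin.Base using (Fin; toℕ)
open import Data.Fin.Properties using (_≟_)
open import Data.Fin.Subset using (Subset; Nonempty)
open import Data.Fin.Subset.Properties using (_∈?_)
open import Data.List.Base using (List; []; _∷_; allFin; filter; foldr; map)
open import Data.List.Extrema.Nat using (max; min)
open import Data.List.Relation.Binary.Permutation.Propositional using (_↭_)
open import Data.Nat.Base as ℕ using (ℕ; NonZero)
open import Data.Nat.ListAction using (sum)
open import Data.Product.Base using (∃-syntax; _×_)
open import Data.Vec.Base as Vec using (Vec; []; _∷_)
open import Level using (suc; _⊔_)
open import Relation.Binary.Core using (Rel)
open import Relation.Binary.Structures using (IsDecTotalOrder)
open import Relation.Nullary.Decidable.Core using (does)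
open import Relation.Nullary.Negation.Core using (¬_)

-- The numbers that algorithms compute with, and the range of the rental cost.
-- ℤ and ℚ are instances; so is ℝ where its order is decidable (classically).
record OrderedCommutativeRing c ℓ₁ ℓ₂ : Set (suc (c ⊔ ℓ₁ ⊔ ℓ₂)) where
  field
    commutativeRing : CommutativeRing c ℓ₁
  open CommutativeRing commutativeRing public
  infix 4 _≤_
  field
    _≤_             : Rel Carrier ℓ₂
    isDecTotalOrder : IsDecTotalOrder _≈_ _≤_
    +-monoˡ-≤       : ∀ {x y} z → x ≤ y → x + z ≤ y + z
    *-nonNeg        : ∀ {x y} → 0# ≤ x → 0# ≤ y → 0# ≤ x * y
    0≉1             : ¬ (0# ≈ 1#)

  open import Algebra.Definitions.RawMonoid +-rawMonoid public
    using () renaming (_×_ to _·_)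

  fromℕ : ℕ → Carrier
  fromℕ n = n · 1#

record Jobs (n : ℕ) : Set where
  field
    p         : Fin n → ℕ
    w         : Fin n → ℕ
    Jʳ        : Subset n
    p-nonZero : ∀ j → NonZero (p j)
    nonempty  : Nonempty Jʳ

module _ {n : ℕ} (I : Jobs n) where
  open Jobs I

  Sequence : List (Fin n) → Set
  Sequence σ = σ ↭ allFin n

  -- The case [] is never reached in a sequence, which contains every job.
  completion : List (Fin n) → Fin n → ℕ
  completion []      j = 0
  completion (i ∷ σ) j = if does (i ≟ j) then p i else p i ℕ.+ completion σ j

  start : List (Fin n) → Fin n → ℕ
  start σ j = completion σ j ℕ.∸ p j

  rJobs : List (Fin n)
  rJobs = filter (_∈? Jʳ) (allFin n)

  -- `max` and `min` take a default value.  Since Jʳ is non-empty, neither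
  -- default matters: every start time is below the total processing time.
  er : List (Fin n) → ℕ
  er σ = max 0 (map (completion σ) rJobs)
         ℕ.∸ min (sum (map p (allFin n))) (map (start σ) rJobs)

  weightedCompletion : List (Fin n) → ℕ
  weightedCompletion σ = sum (map (λ j → w j ℕ.* completion σ j) (allFin n))

module _ {c ℓ₁ ℓ₂} (K : OrderedCommutativeRing c ℓ₁ ℓ₂) where
  open OrderedCommutativeRing K

  record Instance (n : ℕ) : Set (c ⊔ ℓ₂) where
    field
      jobs   : Jobs n
      rate   : Carrier
      0≤rate : 0# ≤ rate
    open Jobs jobs public

  module _ {n : ℕ} (I : Instance n) where
    open Instance I

    cost : List (Fin n) → Carrier
    cost σ = fromℕ (weightedCompletion jobs σ) + rate * fromℕ (er jobs σ)

    Optimal : List (Fin n) → Set ℓ₂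
    Optimal σ = Sequence jobs σ × (∀ τ → Sequence jobs τ → cost σ ≤ cost τ)

-- Algorithms are finite systems of mutually recursive first-order functions over
-- numbers and cons cells.  Programs do not mention the ordered ring, and can
-- inspect numbers only through the operations below.

data Op : Set where
  add sub mul : Op

-- `arity` gives the arities of the functions; `n` variables are in scope.
data Exp {m : ℕ} (arity : Fin m → ℕ) (n : ℕ) : Set where
  var   : Fin n → Exp arity n
  lit   : ℕ → Exp arity n
  op    : Op → Exp arity n → Exp arity n → Exp arity n
  ifle  : (a b s t : Exp arity n) → Exp arity n
  nil   : Exp arity n
  cons  : Exp arity n → Exp arity n → Exp arity n
  -- In the last branch, variable 0 is the head and variable 1 the tail.
  case  : Exp arity n → Exp arity n → Exp arity (2 ℕ.+ n) → Exp arity n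
  letin : Exp arity n → Exp arity (1 ℕ.+ n) → Exp arity n
  call  : (f : Fin m) → Vec (Exp arity n) (arity f) → Exp arity n

-- `main` has two arguments: the rental cost and the list of jobs.
record Program : Set where
  field
    size  : ℕ
    arity : Fin size → ℕ
    body  : (f : Fin size) → Exp arity (arity f)
    main  : Exp arity 2

module _ {c ℓ₁ ℓ₂} (K : OrderedCommutativeRing c ℓ₁ ℓ₂) where
  open OrderedCommutativeRing K

  data Val : Set c where
    num  : Carrier → Val
    nil  : Val
    cons : Val → Val → Val

  ⟦_⟧ : Op → Carrier → Carrier → Carrier
  ⟦ add ⟧ = _+_
  ⟦ sub ⟧ = _-_
  ⟦ mul ⟧ = _*_

  module _ (P : Program) where
    open Program P

    infix 4 _⊢_⇓_[_] _⊢*_⇓_[_]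

    -- ρ ⊢ e ⇓ v [ t ]: in environment ρ, e evaluates to v in t steps.  Every
    -- evaluated node of an expression is one step, so that arithmetic,
    -- comparisons, list operations and calls all have unit cost.
    data _⊢_⇓_[_] {n} (ρ : Vec Val n) : Exp arity n → Val → ℕ → Set (c ⊔ ℓ₂)
    data _⊢*_⇓_[_] {n} (ρ : Vec Val n) :
         ∀ {k} → Vec (Exp arity n) k → Vec Val k → ℕ → Set (c ⊔ ℓ₂)

    data _⊢_⇓_[_] {n} ρ where
      var : ∀ {i} → ρ ⊢ var i ⇓ Vec.lookup ρ i [ 1 ]

      lit : ∀ {k} → ρ ⊢ lit k ⇓ num (fromℕ k) [ 1 ]

      op : ∀ {o a b x y t u} →
           ρ ⊢ a ⇓ num x [ t ] → ρ ⊢ b ⇓ num y [ u ] →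
           ρ ⊢ op o a b ⇓ num (⟦ o ⟧ x y) [ 1 ℕ.+ t ℕ.+ u ]

      ifle-yes : ∀ {a b d e x y v t u s} →
                 ρ ⊢ a ⇓ num x [ t ] → ρ ⊢ b ⇓ num y [ u ] →
                 x ≤ y → ρ ⊢ d ⇓ v [ s ] →
                 ρ ⊢ ifle a b d e ⇓ v [ 1 ℕ.+ t ℕ.+ u ℕ.+ s ]

      ifle-no : ∀ {a b d e x y v t u s} →
                ρ ⊢ a ⇓ num x [ t ] → ρ ⊢ b ⇓ num y [ u ] →
                ¬ (x ≤ y) → ρ ⊢ e ⇓ v [ s ] →
                ρ ⊢ ifle a b d e ⇓ v [ 1 ℕ.+ t ℕ.+ u ℕ.+ s ]

      nil : ρ ⊢ nil ⇓ nil [ 1 ]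

      cons : ∀ {a b x y t u} →
             ρ ⊢ a ⇓ x [ t ] → ρ ⊢ b ⇓ y [ u ] →
             ρ ⊢ cons a b ⇓ cons x y [ 1 ℕ.+ t ℕ.+ u ]

      case-nil : ∀ {a d e v t u} →
                 ρ ⊢ a ⇓ nil [ t ] → ρ ⊢ d ⇓ v [ u ] →
                 ρ ⊢ case a d e ⇓ v [ 1 ℕ.+ t ℕ.+ u ]

      case-cons : ∀ {a d e x y v t u} →
                  ρ ⊢ a ⇓ cons x y [ t ] → (x ∷ y ∷ ρ) ⊢ e ⇓ v [ u ] →
                  ρ ⊢ case a d e ⇓ v [ 1 ℕ.+ t ℕ.+ u ]

      letin : ∀ {a e x v t u} →
              ρ ⊢ a ⇓ x [ t ] → (x ∷ ρ) ⊢ e ⇓ v [ u ] →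
              ρ ⊢ letin a e ⇓ v [ 1 ℕ.+ t ℕ.+ u ]

      call : ∀ {f as xs v t u} →
             ρ ⊢* as ⇓ xs [ t ] → xs ⊢ body f ⇓ v [ u ] →
             ρ ⊢ call f as ⇓ v [ 1 ℕ.+ t ℕ.+ u ]

    data _⊢*_⇓_[_] {n} ρ where
      []  : ρ ⊢* [] ⇓ [] [ 0 ]
      _∷_ : ∀ {k a x t u} {as : Vec (Exp arity n) k} {xs} →
            ρ ⊢ a ⇓ x [ t ] → ρ ⊢* as ⇓ xs [ u ] →
            ρ ⊢* (a ∷ as) ⇓ (x ∷ xs) [ t ℕ.+ u ]

  list : List Val → Val
  list = foldr cons nil

  label : ∀ {n} → Fin n → Val
  label j = num (fromℕ (toℕ j))

  module _ {n : ℕ} (I : Instance K n) where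
    open Instance I

    -- A job is presented as (label , p , w , 1 or 0), the last component
    -- telling whether it is an r-job.
    job : Fin n → Val
    job j = cons (label j) (cons (num (fromℕ (p j))) (cons (num (fromℕ (w j)))
      (num (fromℕ (if does (j ∈? Jʳ) then 1 else 0)))))

    input : Vec Val 2
    input = num rate ∷ list (map job (allFin n)) ∷ []

    SolvesWithin : Program → ℕ → Set (c ⊔ ℓ₂)
    SolvesWithin P b = ∃[ σ ] ∃[ t ]
      _⊢_⇓_[_] P input (Program.main P) (list (map label σ)) t
      × Optimal K I σ × t ℕ.≤ b

-- P outputs an optimal sequence of every instance, over every ordered ring,
-- within T n steps, where n is the number of jobs.
SolvesInTime : ∀ c ℓ₁ ℓ₂ → Program → (ℕ → ℕ) → Set (suc (c ⊔ ℓ₁ ⊔ ℓ₂))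
SolvesInTime c ℓ₁ ℓ₂ P T =
  (K : OrderedCommutativeRing c ℓ₁ ℓ₂) (n : ℕ) (I : Instance K n) →
  SolvesWithin K I P (T n)

O : (ℕ → ℕ) → (ℕ → ℕ) → Set
O g f = ∃[ C ] ∃[ n₀ ] (∀ n → n₀ ℕ.≤ n → f n ℕ.≤ C ℕ.* g n)

{-# OPTIONS --safe #-}
-- A job outside Jʳ interacts with the r-jobs only through the set U of r-jobs that precede
-- it, and its share of the cost is smallest for U = ∅, for U = Jʳ, or for U the r-jobs of at
-- least its own ratio w / p; in the last case it lies inside the renting period.  All other
-- pairs of jobs are best ordered by ratio.  Replacing every share by its minimum bounds the
-- cost of each sequence from below.  The minima are attained simultaneously, because the
-- best of the three places moves from before through inside to after as the ratio decreases:
-- after sorting by ratio, it suffices to output the three classes one after the other.  The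
-- shares of all jobs follow from prefix sums over the sorted list, so merge sort dominates.
module Submission where

import Algebra.Properties.CommutativeSemigroup as CommutativeSemigroup
open import Data.Bool.Base using (Bool; true; false; if_then_else_; _∨_; _∧_)
open import Data.Bool.ListAction using (any)
open import Data.Fin.Base using (Fin)
open import Data.Fin.Patterns
import Data.Fin.Properties as Fin
open import Data.Fin.Subset using () renaming (_∈_ to _∈ˢ_)
open import Data.Fin.Subset.Properties using (_∈?_)
open import Data.List.Base using (List; []; _∷_; _++_; [_]; allFin; concat; filter; foldr; length; map; merge)
open import Data.List.Extrema.Nat using (max; min; max≤v⁺; v≤max⁺; min≤v⁺; v≤min⁺)
open import Data.List.Membership.Propositional using (_∈_)
open import Data.List.Membership.Propositional.Properties using (∈-allFin; ∈-filter⁺)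
open import Data.List.Properties
  using (concat-map-[_]; filter-accept; filter-reject; foldr-++; length-++; length-map; length-tabulate; map-++; map-cong; map-cong-local)
open import Data.List.Relation.Binary.Permutation.Propositional as Perm using (_↭_; ↭-sym; ↭-trans)
open import Data.List.Relation.Binary.Permutation.Propositional.Properties
  using (map⁺; shift; ++⁺ˡ; ∈-resp-↭; ↭-length)
open import Data.List.Relation.Binary.Permutation.Setoid.Properties using (Unique-resp-↭)
open import Data.List.Relation.Unary.All as All using (All; []; _∷_)
import Data.List.Relation.Unary.All.Properties as All
open import Data.List.Relation.Unary.AllPairs as AllPairs using (AllPairs; []; _∷_)
open import Data.List.Relation.Unary.AllPairs.Properties using (++⁺; filter⁺)
open import Data.List.Relation.Unary.Any as Any using (here; there)
import Data.List.Relation.Unary.Any.Properties as Any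
open import Data.List.Relation.Unary.Sorted.TotalOrder.Properties using (Sorted⇒AllPairs)
open import Data.List.Relation.Unary.Unique.Propositional using (Unique)
open import Data.List.Relation.Unary.Unique.Propositional.Properties using (allFin⁺)
open import Data.List.Sort.Base using (SortingAlgorithm)
import Data.List.Sort.MergeSort as MergeSort
import Data.List.Sort.MergeSort.Properties as MergeSortProperties
open import Data.Nat.Base using (ℕ; zero; suc; _+_; _*_; _∸_; _^_; _⊓_; _≤_; _<_; z≤n; s≤s; NonZero)
open import Data.Nat.ListAction using (sum)
open import Data.Nat.ListAction.Properties using (sum-↭)
open import Data.Nat.Logarithm using (⌊log₂_⌋; ⌊log₂⌋-mono-≤; ⌊log₂[2^n]⌋≡n)
open import Data.Nat.Properties
open import Data.Nat.Tactic.RingSolver using (solve-∀)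
open import Data.Product.Base using (_×_; _,_; proj₁; proj₂; swap; ∃-syntax)
open import Data.Sum.Base as Sum using (_⊎_; inj₁; inj₂)
open import Data.Vec.Base using (Vec; []; _∷_)
open import Function.Base using (id; _∘_)
open import Induction.WellFounded using (Acc; acc)
import Level
open import Relation.Binary.Bundles using (DecTotalOrder)
open import Relation.Binary.Core using (Rel)
open import Relation.Binary.Definitions using (Decidable; Total; Transitive)
open import Relation.Binary.PropositionalEquality hiding ([_])
open import Relation.Binary.Structures using (IsDecTotalOrder)
open import Relation.Nullary.Decidable using (Dec; does; yes; no; dec-true; dec-false; map′; _×-dec_)
open import Relation.Nullary.Negation using (¬_; contradiction)
open import Defs

-- Divided by its processing time, each of the three costs of a job outside `Jʳ` depends on its
-- ratio ρ alone: `Wʳ` before, `ρ Pʳ` after, and inside the sum of `min(w z, ρ p z)` over the r-jobs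
-- z, plus λ. The last grows with ρ, but no faster than `ρ Pʳ`. Hence each pairwise comparison of
-- places changes at most once as ρ falls, always towards the later place. The difficulty is to be
-- optimal for all pairs at once: two jobs outside `Jʳ` must end up in ratio order although they are
-- spread over three classes. Monotonicity grants this only if ties between places are broken by a
-- fixed rule, since two places can cost the same on a whole range of ratios. The rent splits over
-- the jobs like the weighted part: an r-job always pays for its own duration, another job exactly
-- when r-jobs lie on both sides of it. The numbers form a ring, where division may be impossible.
-- Costs are therefore pairs of naturals under an abstract total preorder, and ratios are compared
-- by cross-multiplication, without subtraction.

private
  module + = CommutativeSemigroup +-commutativeSemigroup
  module * = CommutativeSemigroup *-commutativeSemigroup

-- Sums over lists and over pairs of list entries

module _ {a} {A : Set a} where

  ∑ : (A → ℕ) → List A → ℕ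
  ∑ f xs = sum (map f xs)

  ∑-cong : ∀ {f g} → (∀ x → f x ≡ g x) → ∀ xs → ∑ f xs ≡ ∑ g xs
  ∑-cong f≗g xs = cong sum (map-cong f≗g xs)

  ∑-mono : ∀ {f g} → (∀ x → f x ≤ g x) → ∀ xs → ∑ f xs ≤ ∑ g xs
  ∑-mono f≤g []       = z≤n
  ∑-mono f≤g (x ∷ xs) = +-mono-≤ (f≤g x) (∑-mono f≤g xs)

  ∑-+ : ∀ f g xs → ∑ (λ x → f x + g x) xs ≡ ∑ f xs + ∑ g xs
  ∑-+ f g []       = refl
  ∑-+ f g (x ∷ xs) = trans (cong (f x + g x +_) (∑-+ f g xs))
                           (+.interchange (f x) (g x) (∑ f xs) (∑ g xs))

  ∑-* : ∀ k f xs → ∑ (λ x → k * f x) xs ≡ k * ∑ f xs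
  ∑-* k f []       = sym (*-zeroʳ k)
  ∑-* k f (x ∷ xs) = trans (cong (k * f x +_) (∑-* k f xs)) (sym (*-distribˡ-+ k (f x) _))

  ∑-↭ : ∀ f {xs ys} → xs ↭ ys → ∑ f xs ≡ ∑ f ys
  ∑-↭ f xs↭ys = sum-↭ (map⁺ f xs↭ys)

  ∑₂ : (A → A → ℕ) → List A → ℕ
  ∑₂ f []       = 0
  ∑₂ f (x ∷ xs) = ∑ (f x) xs + ∑₂ f xs

  ∑₂-mono : ∀ {f g xs} → AllPairs (λ x y → f x y ≤ g x y) xs → ∑₂ f xs ≤ ∑₂ g xs
  ∑₂-mono []         = z≤n
  ∑₂-mono (px ∷ pxs) = +-mono-≤ (mono px) (∑₂-mono pxs)
    where
    mono : ∀ {f g xs} → All (λ y → f y ≤ g y) xs → ∑ f xs ≤ ∑ g xs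
    mono []       = z≤n
    mono (p ∷ ps) = +-mono-≤ p (mono ps)

  -- Pairs are summed in list order, so invariance takes a symmetric summand. The lower bound has
  -- one (`pair`); the actual cost (`lead`) does not.
  ∑₂-↭ : ∀ {f} → (∀ x y → f x y ≡ f y x) → ∀ {xs ys} → xs ↭ ys → ∑₂ f xs ≡ ∑₂ f ys
  ∑₂-↭ f-sym Perm.refl            = refl
  ∑₂-↭ f-sym (Perm.prep x xs↭ys)  = cong₂ _+_ (∑-↭ _ xs↭ys) (∑₂-↭ f-sym xs↭ys)
  ∑₂-↭ {f} f-sym {_ ∷ _ ∷ xs} {_ ∷ _ ∷ ys} (Perm.swap x y xs↭ys) = begin
    f x y + ∑ (f x) xs + (∑ (f y) xs + ∑₂ f xs)
      ≡⟨ cong₂ _+_ (cong₂ _+_ (f-sym x y) (∑-↭ _ xs↭ys)) (cong₂ _+_ (∑-↭ _ xs↭ys) (∑₂-↭ f-sym xs↭ys)) ⟩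
    f y x + ∑ (f x) ys + (∑ (f y) ys + ∑₂ f ys)
      ≡⟨ +.interchange (f y x) (∑ (f x) ys) (∑ (f y) ys) (∑₂ f ys) ⟩
    f y x + ∑ (f y) ys + (∑ (f x) ys + ∑₂ f ys) ∎
    where
    open ≡-Reasoning
  ∑₂-↭ f-sym (Perm.trans p q)     = trans (∑₂-↭ f-sym p) (∑₂-↭ f-sym q)

-- Costs as pairs under an abstract order

-- The pair (a , c) stands for the cost a + λ c.
record CostOrder ℓ : Set (Level.suc ℓ) where
  infix 4 _≼_ _≼?_
  field
    _≼_      : Rel (ℕ × ℕ) ℓ
    _≼?_     : Decidable _≼_
    ≼-trans  : Transitive _≼_
    ≼-total  : Total _≼_
    ≤⇒≼      : ∀ {a b c d} → a ≤ b → c ≤ d → (a , c) ≼ (b , d)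
    +-mono   : ∀ {a b c d a′ b′ c′ d′} → (a , c) ≼ (b , d) → (a′ , c′) ≼ (b′ , d′) →
               (a + a′ , c + c′) ≼ (b + b′ , d + d′)
    +-cancel : ∀ {a b c d} x y → (x + a , y + c) ≼ (x + b , y + d) → (a , c) ≼ (b , d)
    *-cancel : ∀ {a b c d} k .{{_ : NonZero k}} → (k * a , k * c) ≼ (k * b , k * d) → (a , c) ≼ (b , d)

  ≡⇒≼ : ∀ {a b c d} → a ≡ b → c ≡ d → (a , c) ≼ (b , d)
  ≡⇒≼ a≡b c≡d = ≤⇒≼ (≤-reflexive a≡b) (≤-reflexive c≡d)

  *-mono : ∀ {a b c d} k → (a , c) ≼ (b , d) → (k * a , k * c) ≼ (k * b , k * d)
  *-mono zero    _ = ≤⇒≼ z≤n z≤n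
  *-mono (suc k) q = +-mono q (*-mono k q)

data Class : Set where
  before inside after : Class

rank : Class → ℕ
rank before = 0
rank inside = 1
rank after  = 2

-- Pairwise contributions, ratio order and renting time

module Scheduling
  {A : Set} (p w : A → ℕ) (r : A → Bool) (p-nonZero : ∀ x → NonZero (p x))
  where

  onʳ onᵒ : (A → ℕ) → A → ℕ
  onʳ f x = if r x then f x else 0
  onᵒ f x = if r x then 0 else f x

  ∑ʳ ∑ᵒ : (A → ℕ) → List A → ℕ
  ∑ʳ f = ∑ (onʳ f)
  ∑ᵒ f = ∑ (onᵒ f)

  onʳ-mono : ∀ {f g} → (∀ x → f x ≤ g x) → ∀ x → onʳ f x ≤ onʳ g x
  onʳ-mono f≤g x with r x
  ... | true  = f≤g x
  ... | false = z≤n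

  onᵒ-mono : ∀ {f g} → (∀ x → f x ≤ g x) → ∀ x → onᵒ f x ≤ onᵒ g x
  onᵒ-mono f≤g x with r x
  ... | true  = z≤n
  ... | false = f≤g x

  onᵒ-cong : ∀ {f g} → (∀ x → f x ≡ g x) → ∀ x → onᵒ f x ≡ onᵒ g x
  onᵒ-cong f≗g x with r x
  ... | true  = refl
  ... | false = f≗g x

  ∑ʳ-* : ∀ k f xs → ∑ʳ (λ x → k * f x) xs ≡ k * ∑ʳ f xs
  ∑ʳ-* k f xs = trans (∑-cong pull xs) (∑-* k (onʳ f) xs)
    where
    pull : ∀ x → onʳ (λ x → k * f x) x ≡ k * onʳ f x
    pull x with r x
    ... | true  = refl
    ... | false = sym (*-zeroʳ k)

  ∑ʳ-+ : ∀ f g xs → ∑ʳ (λ x → f x + g x) xs ≡ ∑ʳ f xs + ∑ʳ g xs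
  ∑ʳ-+ f g xs = trans (∑-cong split xs) (∑-+ (onʳ f) (onʳ g) xs)
    where
    split : ∀ x → onʳ (λ x → f x + g x) x ≡ onʳ f x + onʳ g x
    split x with r x
    ... | true  = refl
    ... | false = refl

  ∑ᵒ-+ : ∀ f g xs → ∑ᵒ (λ x → f x + g x) xs ≡ ∑ᵒ f xs + ∑ᵒ g xs
  ∑ᵒ-+ f g xs = trans (∑-cong split xs) (∑-+ (onᵒ f) (onᵒ g) xs)
    where
    split : ∀ x → onᵒ (λ x → f x + g x) x ≡ onᵒ f x + onᵒ g x
    split x with r x
    ... | true  = refl
    ... | false = refl

  ∑-split : ∀ f xs → ∑ f xs ≡ ∑ʳ f xs + ∑ᵒ f xs
  ∑-split f xs = trans (∑-cong split xs) (∑-+ (onʳ f) (onᵒ f) xs)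
    where
    split : ∀ x → f x ≡ onʳ f x + onᵒ f x
    split x with r x
    ... | true  = sym (+-identityʳ (f x))
    ... | false = refl

  ∑ʳ-none : ∀ f xs → any r xs ≡ false → ∑ʳ f xs ≡ 0
  ∑ʳ-none f []       _  = refl
  ∑ʳ-none f (x ∷ xs) eq with r x
  ... | false = ∑ʳ-none f xs eq

  module _ (f : A → ℕ) {x : A} (xs : List A) where

    ∑ʳ-r : r x ≡ true → ∑ʳ f (x ∷ xs) ≡ f x + ∑ʳ f xs
    ∑ʳ-r = cong (λ b → (if b then f x else 0) + ∑ʳ f xs)

    ∑ʳ-o : r x ≡ false → ∑ʳ f (x ∷ xs) ≡ ∑ʳ f xs
    ∑ʳ-o = cong (λ b → (if b then f x else 0) + ∑ʳ f xs)

    ∑ᵒ-r : r x ≡ true → ∑ᵒ f (x ∷ xs) ≡ ∑ᵒ f xs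
    ∑ᵒ-r = cong (λ b → (if b then 0 else f x) + ∑ᵒ f xs)

    ∑ᵒ-o : r x ≡ false → ∑ᵒ f (x ∷ xs) ≡ f x + ∑ᵒ f xs
    ∑ᵒ-o = cong (λ b → (if b then 0 else f x) + ∑ᵒ f xs)

  -- The contribution p x * w y of a pair to ∑ wⱼ Cⱼ when x precedes y.
  lead : A → A → ℕ
  lead x y = p x * w y

  -- `w x * p y` is `lead y x` with its factors swapped: the order of the two jobs decides which
  -- term is paid, and ratio order pays the smaller one.
  least : A → A → ℕ
  least x y = p x * w y ⊓ (w x * p y)

  least-sym : ∀ x y → least x y ≡ least y x
  least-sym x y = trans (⊓-comm (p x * w y) (w x * p y))
                        (cong₂ _⊓_ (*-comm (w x) (p y)) (*-comm (p x) (w y)))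

  -- w x / p x ≥ w y / p y
  infix 4 _⊵_
  _⊵_ : A → A → Set
  x ⊵ y = p x * w y ≤ w x * p y

  ⊵⇒least : ∀ {x y} → x ⊵ y → least x y ≡ p x * w y
  ⊵⇒least = m≤n⇒m⊓n≡m

  ⊵-refl : ∀ x → x ⊵ x
  ⊵-refl x = ≤-reflexive (*-comm (p x) (w x))

  ⊵-trans : Transitive _⊵_
  ⊵-trans {x} {y} {z} x⊵y y⊵z = *-cancelˡ-≤ (p y) {{p-nonZero y}} (begin
    p y * (p x * w z) ≡⟨ *.x∙yz≈y∙xz (p y) (p x) (w z) ⟩
    p x * (p y * w z) ≤⟨ *-monoʳ-≤ (p x) y⊵z ⟩
    p x * (w y * p z) ≡⟨ *-assoc (p x) (w y) (p z) ⟨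
    p x * w y * p z   ≤⟨ *-monoˡ-≤ (p z) x⊵y ⟩
    w x * p y * p z   ≡⟨ *.xy∙z≈y∙xz (w x) (p y) (p z) ⟩
    p y * (w x * p z) ∎)
    where
    open ≤-Reasoning

  ⊵-total : ∀ x y → (x ⊵ y) ⊎ (y ⊵ x)
  ⊵-total x y with ≤-total (p x * w y) (w x * p y)
  ... | inj₁ le = inj₁ le
  ... | inj₂ ge = inj₂ (subst₂ _≤_ (*-comm (w x) (p y)) (*-comm (p x) (w y)) ge)

  infix 4 _⊵?_
  _⊵?_ : Decidable _⊵_
  x ⊵? y = p x * w y ≤? w x * p y

  byRatio : DecTotalOrder _ _ _
  byRatio = record
    { _≈_ = λ x y → x ⊵ y × y ⊵ x
    ; _≤_ = _⊵_
    ; isDecTotalOrder = record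
      { isTotalOrder = record
        { isPartialOrder = record
          { isPreorder = record
            { isEquivalence = record
              { refl  = λ {x} → ⊵-refl x , ⊵-refl x
              ; sym   = swap
              ; trans = λ (x⊵y , y⊵x) (y⊵z , z⊵y) → ⊵-trans x⊵y y⊵z , ⊵-trans z⊵y y⊵x
              }
            ; reflexive = proj₁
            ; trans     = ⊵-trans
            }
          ; antisym = _,_
          }
        ; total = ⊵-total
        }
      ; _≟_  = λ x y → x ⊵? y ×-dec y ⊵? x
      ; _≤?_ = _⊵?_
      }
    }

  open MergeSort byRatio public using (mergePairs; mergeAll; sort)

  sort-↭ : ∀ xs → sort xs ↭ xs
  sort-↭ = SortingAlgorithm.sort-↭ (MergeSort.mergeSort byRatio)

  sort-⊵ : ∀ xs → AllPairs _⊵_ (sort xs)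
  sort-⊵ xs = Sorted⇒AllPairs (DecTotalOrder.totalOrder byRatio)
                (SortingAlgorithm.sort-↗ (MergeSort.mergeSort byRatio) xs)

  -- This is the sum of all `w j * C j` in pair form: a job waits for itself and for each
  -- predecessor. Only the second summand depends on the order.
  weighted : List A → ℕ
  weighted xs = ∑ (λ x → p x * w x) xs + ∑₂ lead xs

  -- The renting time during xs, where b tells whether an r-job precedes xs.
  span : Bool → List A → ℕ
  span b []       = 0
  span b (x ∷ xs) = (if r x ∨ (b ∧ any r xs) then p x else 0) + span (r x ∨ b) xs

  -- What a job `x` outside `Jʳ` and an r-job `y` are charged together when `x` is assigned the
  -- given class.
  cross : Class → A → A → ℕ
  cross before x y = p x * w y
  cross inside x y = least x y
  cross after  x y = w x * p y

  -- The best place of a job relative to the r-jobs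

  module Classes {ℓ} (O : CostOrder ℓ) (J : List A) where
    open CostOrder O

    Pʳ Wʳ : ℕ
    Pʳ = ∑ʳ p J
    Wʳ = ∑ʳ w J

    M : A → ℕ
    M x = ∑ʳ (least x) J

    -- Ties favour `before` over both other places and `after` over `inside`. The conditionals nest
    -- as in the program, so that its branches evaluate to the class directly.
    classify : ∀ {a b c} {P : Set a} {Q : Set b} {R : Set c} → Dec P → Dec Q → Dec R → Class
    classify P? Q? R? = if does P? then (if does Q? then before else inside)
                                   else (if does R? then after else inside)

    -- The second component is the renting time caused by `x`: only between r-jobs does it prolong
    -- the rental.
    beforeCost insideCost afterCost : A → ℕ × ℕ
    beforeCost x = p x * Wʳ , 0
    insideCost x = M x , p x
    afterCost  x = w x * Pʳ , 0

    -- The cheapest place for a job outside Jʳ relative to the jobs of Jʳ alone.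
    classᵒ : A → Class
    classᵒ x = classify (beforeCost x ≼? afterCost x) (beforeCost x ≼? insideCost x)
                        (afterCost x ≼? insideCost x)

    class : A → Class
    class x = if r x then inside else classᵒ x

    class-r : ∀ {x} → r x ≡ true → class x ≡ inside
    class-r {x} = cong (λ b → if b then inside else classᵒ x)

    class-o : ∀ {x} → r x ≡ false → class x ≡ classᵒ x
    class-o {x} = cong (λ b → if b then inside else classᵒ x)

    -- `after` records a failed comparison rather than a converse inequality, because `rank-monoᵒ`
    -- has to transport the tie-breaking rule from one job to another by contraposition.
    data Spec (x : A) : Class → Set ℓ where
      before : beforeCost x ≼ afterCost x → beforeCost x ≼ insideCost x → Spec x before
      inside : insideCost x ≼ beforeCost x → insideCost x ≼ afterCost x → Spec x inside
      after  : ¬ (beforeCost x ≼ afterCost x) → afterCost x ≼ insideCost x → Spec x after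

    ⋠⇒≽ : ∀ {x y} → ¬ (x ≼ y) → y ≼ x
    ⋠⇒≽ {x} {y} x⋠y with ≼-total x y
    ... | inj₁ x≼y = contradiction x≼y x⋠y
    ... | inj₂ y≼x = y≼x

    spec : ∀ x → Spec x (classᵒ x)
    spec x with beforeCost x ≼? afterCost x | beforeCost x ≼? insideCost x | afterCost x ≼? insideCost x
    ... | yes b≼a | yes b≼i | _       = before b≼a b≼i
    ... | yes b≼a | no  b⋠i | _       = inside (⋠⇒≽ b⋠i) (≼-trans (⋠⇒≽ b⋠i) b≼a)
    ... | no  b⋠a | _       | yes a≼i = after b⋠a a≼i
    ... | no  b⋠a | _       | no  a⋠i = inside (≼-trans (⋠⇒≽ a⋠i) (⋠⇒≽ b⋠a)) (⋠⇒≽ a⋠i)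

    class-before : ∀ x → beforeCost x ≼ afterCost x → beforeCost x ≼ insideCost x → classᵒ x ≡ before
    class-before x b≼a b≼i with beforeCost x ≼? afterCost x | beforeCost x ≼? insideCost x
    ... | yes _   | yes _   = refl
    ... | yes _   | no  b⋠i = contradiction b≼i b⋠i
    ... | no  b⋠a | _       = contradiction b≼a b⋠a

    class-after : ∀ x → ¬ (beforeCost x ≼ afterCost x) → afterCost x ≼ insideCost x → classᵒ x ≡ after
    class-after x b⋠a a≼i with beforeCost x ≼? afterCost x | afterCost x ≼? insideCost x
    ... | yes b≼a | _       = contradiction b≼a b⋠a
    ... | no  _   | yes _   = refl
    ... | no  _   | no  a⋠i = contradiction a≼i a⋠i

    -- Monotonicity of the best place in the ratio

    module _ {x y} (x⊵y : x ⊵ y) where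

      private instance _ = p-nonZero y
                       _ = p-nonZero x

      -- Per unit of processing time, `before` costs the constant `Wʳ` and `after` costs the ratio
      -- times `Pʳ`. Scaling by `p x` and `p y` replaces the division.
      before≼after-mono : beforeCost y ≼ afterCost y → beforeCost x ≼ afterCost x
      before≼after-mono b≼a = *-cancel (p y) (≼-trans (≡⇒≼ (*.x∙yz≈y∙xz (p y) (p x) Wʳ) e₀)
        (≼-trans (*-mono (p x) b≼a) (≤⇒≼ le (≤-reflexive (sym e₀)))))
        where
        open ≤-Reasoning
        e₀ : p y * 0 ≡ p x * 0
        e₀ = trans (*-zeroʳ (p y)) (sym (*-zeroʳ (p x)))
        le : p x * (w y * Pʳ) ≤ p y * (w x * Pʳ)
        le = begin
          p x * (w y * Pʳ) ≡⟨ *-assoc (p x) (w y) Pʳ ⟨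
          p x * w y * Pʳ   ≤⟨ *-monoˡ-≤ Pʳ x⊵y ⟩
          w x * p y * Pʳ   ≡⟨ *.xy∙z≈y∙xz (w x) (p y) Pʳ ⟩
          p y * (w x * Pʳ) ∎

      -- `M x`, divided by `p x`, is a sum of minima of `w z` and the ratio times `p z`, hence
      -- nondecreasing in the ratio.
      scaled-M-mono : p x * M y ≤ p y * M x
      scaled-M-mono = begin
        p x * M y                            ≡⟨ ∑ʳ-* (p x) (least y) J ⟨
        ∑ʳ (λ z → p x * least y z) J         ≤⟨ ∑-mono (onʳ-mono le) J ⟩
        ∑ʳ (λ z → p y * least x z) J         ≡⟨ ∑ʳ-* (p y) (least x) J ⟩
        p y * M x                            ∎
        where
        open ≤-Reasoning
        le : ∀ z → p x * least y z ≤ p y * least x z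
        le z = begin
          p x * least y z
            ≡⟨ *-distribˡ-⊓ (p x) _ _ ⟩
          p x * (p y * w z) ⊓ (p x * (w y * p z))
            ≡⟨ cong₂ _⊓_ (*.x∙yz≈y∙xz (p x) (p y) (w z)) (sym (*-assoc (p x) (w y) (p z))) ⟩
          p y * (p x * w z) ⊓ (p x * w y * p z)
            ≤⟨ ⊓-monoʳ-≤ (p y * (p x * w z)) (*-monoˡ-≤ (p z) x⊵y) ⟩
          p y * (p x * w z) ⊓ (w x * p y * p z)
            ≡⟨ cong (p y * (p x * w z) ⊓_) (*.xy∙z≈y∙xz (w x) (p y) (p z)) ⟩
          p y * (p x * w z) ⊓ (p y * (w x * p z))
            ≡⟨ *-distribˡ-⊓ (p y) _ _ ⟨
          p y * least x z ∎

      before≼inside-mono : beforeCost y ≼ insideCost y → beforeCost x ≼ insideCost x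
      before≼inside-mono b≼i = *-cancel (p y) (≼-trans (≡⇒≼ (*.x∙yz≈y∙xz (p y) (p x) Wʳ) e₀)
        (≼-trans (*-mono (p x) b≼i) (≤⇒≼ scaled-M-mono (≤-reflexive (*-comm (p x) (p y))))))
        where
        e₀ : p y * 0 ≡ p x * 0
        e₀ = trans (*-zeroʳ (p y)) (sym (*-zeroʳ (p x)))

      -- w x * Pʳ ∸ M x, relative to p x, grows with the ratio of w x to p x; both sides
      -- are moved so that no subtraction occurs.
      after∸M-mono : p y * M x + p x * (w y * Pʳ) ≤ p x * M y + p y * (w x * Pʳ)
      after∸M-mono = begin
        p y * M x + p x * (w y * Pʳ)
          ≡⟨ sums (p y) (p x) (w y) (least x) ⟨
        ∑ʳ (λ z → p y * least x z + p x * (w y * p z)) J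
          ≤⟨ ∑-mono (onʳ-mono le) J ⟩
        ∑ʳ (λ z → p x * least y z + p y * (w x * p z)) J
          ≡⟨ sums (p x) (p y) (w x) (least y) ⟩
        p x * M y + p y * (w x * Pʳ) ∎
        where
        open ≤-Reasoning
        sums : ∀ a b c f → ∑ʳ (λ z → a * f z + b * (c * p z)) J ≡ a * ∑ʳ f J + b * (c * Pʳ)
        sums a b c f = trans (∑ʳ-+ (λ z → a * f z) (λ z → b * (c * p z)) J)
          (cong₂ _+_ (∑ʳ-* a f J) (trans (∑ʳ-* b (λ z → c * p z) J) (cong (b *_) (∑ʳ-* c p J))))
        -- Truncating at `c` cannot widen the gap between `a` and `b`.
        exchange : ∀ {a b} c → a ≤ b → c ⊓ b + a ≤ c ⊓ a + b
        exchange {a} {b} c a≤b = begin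
          c ⊓ b + a         ≤⟨ ⊓-glb (+-mono-≤ (m⊓n≤m c b) a≤b)
                                     (≤-trans (+-monoˡ-≤ a (m⊓n≤n c b)) (≤-reflexive (+-comm b a))) ⟩
          (c + b) ⊓ (a + b) ≡⟨ +-distribʳ-⊓ b c a ⟨
          c ⊓ a + b         ∎
        le : ∀ z → p y * least x z + p x * (w y * p z) ≤ p x * least y z + p y * (w x * p z)
        le z = begin
          p y * least x z + p x * (w y * p z)
            ≡⟨ cong (_+ p x * (w y * p z)) (*-distribˡ-⊓ (p y) _ _) ⟩
          p y * (p x * w z) ⊓ (p y * (w x * p z)) + p x * (w y * p z)
            ≤⟨ exchange (p y * (p x * w z)) scaled ⟩
          p y * (p x * w z) ⊓ (p x * (w y * p z)) + p y * (w x * p z)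
            ≡⟨ cong (λ s → s ⊓ (p x * (w y * p z)) + p y * (w x * p z)) (*.x∙yz≈y∙xz (p y) (p x) (w z)) ⟩
          p x * (p y * w z) ⊓ (p x * (w y * p z)) + p y * (w x * p z)
            ≡⟨ cong (_+ p y * (w x * p z)) (*-distribˡ-⊓ (p x) _ _) ⟨
          p x * least y z + p y * (w x * p z) ∎
          where
          scaled : p x * (w y * p z) ≤ p y * (w x * p z)
          scaled = begin
            p x * (w y * p z) ≡⟨ *-assoc (p x) (w y) (p z) ⟨
            p x * w y * p z   ≤⟨ *-monoˡ-≤ (p z) x⊵y ⟩
            w x * p y * p z   ≡⟨ *.xy∙z≈y∙xz (w x) (p y) (p z) ⟩
            p y * (w x * p z) ∎

      -- Per unit of processing time, the excess of `afterCost` over `M` is weighed against the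
      -- constant rate, and it shrinks with the ratio. Adding `p y * M x` and the rent for
      -- `p y * p x` to both sides brings the claim into the form of `after∸M-mono`.
      after≼inside-mono : afterCost x ≼ insideCost x → afterCost y ≼ insideCost y
      after≼inside-mono a≼i = *-cancel (p x) (+-cancel (p y * M x) (p y * p x) (≼-trans
        (≤⇒≼ after∸M-mono (≤-reflexive (cong₂ _+_ (*-comm (p y) (p x)) (e₀ (p x) (p y)))))
        (≼-trans (+-mono (≤⇒≼ ≤-refl ≤-refl) (*-mono (p y) a≼i))
          (≡⇒≼ (+-comm (p x * M y) _) (+-comm (p x * p y) _)))))
        where
        e₀ : ∀ a b → a * 0 ≡ b * 0
        e₀ a b = trans (*-zeroʳ a) (sym (*-zeroʳ b))

      -- Two implications suffice: if `y` goes before, so does `x`; if `x` goes after, so does `y`.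
      -- All remaining combinations are in order.
      rank-monoᵒ : rank (classᵒ x) ≤ rank (classᵒ y)
      rank-monoᵒ with classᵒ y in y-class | spec y
      ... | before | before b≼a b≼i
          rewrite class-before x (before≼after-mono b≼a) (before≼inside-mono b≼i) = z≤n
      ... | after | _ = rank≤2 (classᵒ x)
        where
        rank≤2 : ∀ c → rank c ≤ 2
        rank≤2 before = z≤n
        rank≤2 inside = s≤s z≤n
        rank≤2 after  = ≤-refl
      ... | inside | _ with classᵒ x | spec x
      ...   | before | _ = z≤n
      ...   | inside | _ = ≤-refl
      ...   | after  | after b⋠a a≼i with () ← trans (sym y-class)
                (class-after y (λ b≼a → b⋠a (before≼after-mono b≼a)) (after≼inside-mono a≼i))

    -- A lower bound independent of the sequence

    weight : Class → A → ℕ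
    weight inside x = p x
    weight _      x = 0

    rented : List A → ℕ
    rented = ∑ (λ x → weight (class x) x)

    -- A mixed pair is charged by the class of its member outside `Jʳ`, whichever job comes first;
    -- this is what makes the charge symmetric.
    pair : A → A → ℕ
    pair x y = if r x then (if r y then least x y else cross (class y) y x)
                      else (if r y then cross (class x) x y else least x y)

    pair-sym : ∀ x y → pair x y ≡ pair y x
    pair-sym x y with r x | r y
    ... | true  | true  = least-sym x y
    ... | true  | false = refl
    ... | false | true  = refl
    ... | false | false = least-sym x y

    -- The cheapest of the three costs, written with `cross` because that is how the shares of `x`
    -- accumulate in `pairs≼`.
    chosen : A → ℕ × ℕ
    chosen x = ∑ʳ (cross (classᵒ x) x) J , weight (classᵒ x) x

    chosen≼before : ∀ x → chosen x ≼ beforeCost x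
    chosen≼before x with classᵒ x | spec x
    ... | before | _               = ≡⇒≼ (∑ʳ-* (p x) w J) refl
    ... | inside | inside i≼b _    = i≼b
    ... | after  | after b⋠a _     = ≼-trans (≡⇒≼ (∑ʳ-* (w x) p J) refl) (⋠⇒≽ b⋠a)

    chosen≼inside : ∀ x → chosen x ≼ insideCost x
    chosen≼inside x with classᵒ x | spec x
    ... | before | before _ b≼i    = ≼-trans (≡⇒≼ (∑ʳ-* (p x) w J) refl) b≼i
    ... | inside | _               = ≡⇒≼ refl refl
    ... | after  | after _ a≼i     = ≼-trans (≡⇒≼ (∑ʳ-* (w x) p J) refl) a≼i

    chosen≼after : ∀ x → chosen x ≼ afterCost x
    chosen≼after x with classᵒ x | spec x
    ... | before | before b≼a _    = ≼-trans (≡⇒≼ (∑ʳ-* (p x) w J) refl) b≼a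
    ... | inside | inside _ i≼a    = i≼a
    ... | after  | _               = ≡⇒≼ (∑ʳ-* (w x) p J) refl

    -- `ys` and `xs` together account for the r-jobs of `J`. Saying so through sums leaves open
    -- which other jobs the two lists contain.
    Split : List A → List A → Set
    Split ys xs = ∀ f → ∑ʳ f J ≡ ∑ʳ f ys + ∑ʳ f xs

    Split-shift : ∀ ys x xs → Split ys (x ∷ xs) → Split (x ∷ ys) xs
    Split-shift ys x xs split f = trans (split f) (+.x∙yz≈yx∙z (∑ʳ f ys) (onʳ f x) (∑ʳ f xs))

    -- A job x outside Jʳ with ys before it and xs after it.
    chosen≼ : ∀ {ys xs} → Split ys xs → ∀ x →
      chosen x ≼ (w x * ∑ʳ p ys + p x * ∑ʳ w xs , (if any r ys ∧ any r xs then p x else 0))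
    chosen≼ {ys} {xs} split x with any r ys in eq | any r xs in eq′
    ... | false | _     = ≼-trans (chosen≼before x) (≤⇒≼ (begin
      p x * Wʳ                       ≡⟨ cong (p x *_) (split w) ⟩
      p x * (∑ʳ w ys + ∑ʳ w xs)      ≡⟨ cong (λ s → p x * (s + ∑ʳ w xs)) (∑ʳ-none w ys eq) ⟩
      p x * ∑ʳ w xs                  ≤⟨ m≤n+m _ _ ⟩
      w x * ∑ʳ p ys + p x * ∑ʳ w xs  ∎) z≤n)
      where open ≤-Reasoning
    ... | true  | false = ≼-trans (chosen≼after x) (≤⇒≼ (begin
      w x * Pʳ                       ≡⟨ cong (w x *_) (split p) ⟩
      w x * (∑ʳ p ys + ∑ʳ p xs)      ≡⟨ cong (λ s → w x * (∑ʳ p ys + s)) (∑ʳ-none p xs eq′) ⟩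
      w x * (∑ʳ p ys + 0)            ≡⟨ cong (w x *_) (+-identityʳ _) ⟩
      w x * ∑ʳ p ys                  ≤⟨ m≤m+n _ _ ⟩
      w x * ∑ʳ p ys + p x * ∑ʳ w xs  ∎) z≤n)
      where open ≤-Reasoning
    -- With r-jobs on both sides, the rent for `p x` is due wherever `x` stands, and each minimum is
    -- at most the term paid in the actual order.
    ... | true  | true  = ≼-trans (chosen≼inside x) (≤⇒≼ (begin
      ∑ʳ (least x) J                           ≡⟨ split (least x) ⟩
      ∑ʳ (least x) ys + ∑ʳ (least x) xs        ≤⟨ +-mono-≤ (∑-mono (onʳ-mono (λ z → m⊓n≤n (p x * w z) _)) ys)
                                                           (∑-mono (onʳ-mono (λ z → m⊓n≤m (p x * w z) _)) xs) ⟩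
      ∑ʳ (λ z → w x * p z) ys + ∑ʳ (lead x) xs ≡⟨ cong₂ _+_ (∑ʳ-* (w x) p ys) (∑ʳ-* (p x) w xs) ⟩
      w x * ∑ʳ p ys + p x * ∑ʳ w xs            ∎) ≤-refl)
      where open ≤-Reasoning

    pairs-with-r : ∀ {x} → r x ≡ true → ∀ xs →
      ∑ (pair x) xs ≡ ∑ʳ (least x) xs + ∑ᵒ (λ o → cross (classᵒ o) o x) xs
    pairs-with-r {x} rx xs = trans (∑-cong e xs) (∑-+ (onʳ (least x)) _ xs)
      where
      e : ∀ y → pair x y ≡ onʳ (least x) y + onᵒ (λ o → cross (classᵒ o) o x) y
      e y rewrite rx with r y
      ... | true  = sym (+-identityʳ _)
      ... | false = refl

    pairs-with-o : ∀ {x} → r x ≡ false → ∀ xs →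
      ∑ (pair x) xs ≡ ∑ʳ (cross (classᵒ x) x) xs + ∑ᵒ (least x) xs
    pairs-with-o {x} rx xs = trans (∑-cong e xs) (∑-+ (onʳ (cross (classᵒ x) x)) _ xs)
      where
      e : ∀ y → pair x y ≡ onʳ (cross (classᵒ x) x) y + onᵒ (least x) y
      e y rewrite rx with r y
      ... | true  = sym (+-identityʳ _)
      ... | false = refl

    -- ys is the part of the sequence that precedes xs; its jobs in Jʳ still have to be
    -- paired with the other jobs of xs.
    pairs≼ : ∀ ys xs → Split ys xs →
      (∑ᵒ (λ o → ∑ʳ (cross (classᵒ o) o) ys) xs + ∑₂ pair xs , rented xs) ≼
      (∑ᵒ (λ o → w o * ∑ʳ p ys) xs + ∑₂ lead xs , span (any r ys) xs)
    pairs≼ ys []       split = ≤⇒≼ ≤-refl ≤-refl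
    pairs≼ ys (x ∷ xs) split = by-type (r x) refl
      where
      G H : A → ℕ
      G o = ∑ʳ (cross (classᵒ o) o) ys
      H o = w o * ∑ʳ p ys
      by-type : ∀ b → r x ≡ b → (∑ᵒ G (x ∷ xs) + ∑₂ pair (x ∷ xs) , rented (x ∷ xs)) ≼
                                (∑ᵒ H (x ∷ xs) + ∑₂ lead (x ∷ xs) , span (any r ys) (x ∷ xs))
      -- An r-job settles its pairs with later r-jobs and joins the prefix; its pairs with later
      -- jobs outside `Jʳ` are deferred to those jobs.
      by-type true rx = ≼-trans (≡⇒≼ left (cong (λ c → weight c x + rented xs) (class-r rx)))
        (≼-trans (+-mono (≤⇒≼ (∑-mono (onʳ-mono (λ z → m⊓n≤m (p x * w z) _)) xs) (≤-refl {p x}))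
                         (pairs≼ (x ∷ ys) xs (Split-shift ys x xs split)))
          (≡⇒≼ right (cong (λ b → (if b ∨ (any r ys ∧ any r xs) then p x else 0) + span (r x ∨ any r ys) xs) (sym rx))))
        where
        e₁ : ∀ a b c d → a + (b + c + d) ≡ b + (c + a + d)
        e₁ = solve-∀
        C : A → ℕ
        C o = cross (classᵒ o) o x
        left : ∑ᵒ G (x ∷ xs) + (∑ (pair x) xs + ∑₂ pair xs) ≡
               ∑ʳ (least x) xs + (∑ᵒ (λ o → ∑ʳ (cross (classᵒ o) o) (x ∷ ys)) xs + ∑₂ pair xs)
        left = begin
          ∑ᵒ G (x ∷ xs) + (∑ (pair x) xs + ∑₂ pair xs)
            ≡⟨ cong₂ (λ s t → s + (t + ∑₂ pair xs)) (∑ᵒ-r G xs rx) (pairs-with-r rx xs) ⟩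
          ∑ᵒ G xs + (∑ʳ (least x) xs + ∑ᵒ C xs + ∑₂ pair xs)
            ≡⟨ e₁ (∑ᵒ G xs) (∑ʳ (least x) xs) (∑ᵒ C xs) (∑₂ pair xs) ⟩
          ∑ʳ (least x) xs + (∑ᵒ C xs + ∑ᵒ G xs + ∑₂ pair xs)
            ≡⟨ cong (λ s → ∑ʳ (least x) xs + (s + ∑₂ pair xs)) (∑ᵒ-+ C G xs) ⟨
          ∑ʳ (least x) xs + (∑ᵒ (λ o → C o + G o) xs + ∑₂ pair xs)
            ≡⟨ cong (λ s → ∑ʳ (least x) xs + (s + ∑₂ pair xs))
                    (∑-cong (onᵒ-cong (λ o → ∑ʳ-r (cross (classᵒ o) o) ys rx)) xs) ⟨
          ∑ʳ (least x) xs + (∑ᵒ (λ o → ∑ʳ (cross (classᵒ o) o) (x ∷ ys)) xs + ∑₂ pair xs) ∎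
          where open ≡-Reasoning
        distrib : ∀ o → w o * ∑ʳ p (x ∷ ys) ≡ lead x o + H o
        distrib o = trans (cong (w o *_) (∑ʳ-r p ys rx))
          (trans (*-distribˡ-+ (w o) (p x) _) (cong (_+ H o) (*-comm (w o) (p x))))
        right : ∑ʳ (lead x) xs + (∑ᵒ (λ o → w o * ∑ʳ p (x ∷ ys)) xs + ∑₂ lead xs) ≡
                ∑ᵒ H (x ∷ xs) + (∑ (lead x) xs + ∑₂ lead xs)
        right = begin
          ∑ʳ (lead x) xs + (∑ᵒ (λ o → w o * ∑ʳ p (x ∷ ys)) xs + ∑₂ lead xs)
            ≡⟨ cong (λ s → ∑ʳ (lead x) xs + (s + ∑₂ lead xs))
                    (trans (∑-cong (onᵒ-cong distrib) xs) (∑ᵒ-+ (lead x) H xs)) ⟩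
          ∑ʳ (lead x) xs + (∑ᵒ (lead x) xs + ∑ᵒ H xs + ∑₂ lead xs)
            ≡⟨ e₁ (∑ᵒ H xs) (∑ʳ (lead x) xs) (∑ᵒ (lead x) xs) (∑₂ lead xs) ⟨
          ∑ᵒ H xs + (∑ʳ (lead x) xs + ∑ᵒ (lead x) xs + ∑₂ lead xs)
            ≡⟨ cong₂ (λ s t → s + (t + ∑₂ lead xs)) (∑ᵒ-r H xs rx) (∑-split (lead x) xs) ⟨
          ∑ᵒ H (x ∷ xs) + (∑ (lead x) xs + ∑₂ lead xs) ∎
          where open ≡-Reasoning
      -- The deferred terms of `x` against `ys` meet its terms against `xs` and form all of
      -- `chosen x`, so `x` is bounded as a whole and need not enter the prefix.
      by-type false rx = ≼-trans (≡⇒≼ left (trans (cong (λ c → weight c x + rented xs) (class-o rx))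
                                                (cong (_+ rented xs) (sym (+-identityʳ _)))))
        (≼-trans (+-mono (+-mono (chosen≼ {ys} {xs} split′ x)
                                 (≤⇒≼ (∑-mono (onᵒ-mono (λ z → m⊓n≤m (p x * w z) _)) xs) (z≤n {0})))
                         (pairs≼ ys xs split′))
          (≡⇒≼ right (trans (cong (_+ span (any r ys) xs) (+-identityʳ _))
            (cong (λ b → (if b ∨ (any r ys ∧ any r xs) then p x else 0) + span (b ∨ any r ys) xs) (sym rx)))))
        where
        split′ : Split ys xs
        split′ f = trans (split f) (cong (∑ʳ f ys +_) (∑ʳ-o f xs rx))
        left : ∑ᵒ G (x ∷ xs) + (∑ (pair x) xs + ∑₂ pair xs) ≡
               ∑ʳ (cross (classᵒ x) x) J + ∑ᵒ (least x) xs + (∑ᵒ G xs + ∑₂ pair xs)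
        left = begin
          ∑ᵒ G (x ∷ xs) + (∑ (pair x) xs + ∑₂ pair xs)
            ≡⟨ cong₂ (λ s t → s + (t + ∑₂ pair xs)) (∑ᵒ-o G xs rx) (pairs-with-o rx xs) ⟩
          G x + ∑ᵒ G xs + (∑ʳ (cross (classᵒ x) x) xs + ∑ᵒ (least x) xs + ∑₂ pair xs)
            ≡⟨ e (G x) (∑ᵒ G xs) (∑ʳ (cross (classᵒ x) x) xs) (∑ᵒ (least x) xs) (∑₂ pair xs) ⟩
          G x + ∑ʳ (cross (classᵒ x) x) xs + ∑ᵒ (least x) xs + (∑ᵒ G xs + ∑₂ pair xs)
            ≡⟨ cong (λ s → s + ∑ᵒ (least x) xs + (∑ᵒ G xs + ∑₂ pair xs)) (split′ (cross (classᵒ x) x)) ⟨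
          ∑ʳ (cross (classᵒ x) x) J + ∑ᵒ (least x) xs + (∑ᵒ G xs + ∑₂ pair xs) ∎
          where
          open ≡-Reasoning
          e : ∀ a b c d e → a + b + (c + d + e) ≡ a + c + d + (b + e)
          e = solve-∀
        right : H x + p x * ∑ʳ w xs + ∑ᵒ (lead x) xs + (∑ᵒ H xs + ∑₂ lead xs) ≡
                ∑ᵒ H (x ∷ xs) + (∑ (lead x) xs + ∑₂ lead xs)
        right = begin
          H x + p x * ∑ʳ w xs + ∑ᵒ (lead x) xs + (∑ᵒ H xs + ∑₂ lead xs)
            ≡⟨ cong (λ s → H x + s + ∑ᵒ (lead x) xs + (∑ᵒ H xs + ∑₂ lead xs)) (∑ʳ-* (p x) w xs) ⟨
          H x + ∑ʳ (lead x) xs + ∑ᵒ (lead x) xs + (∑ᵒ H xs + ∑₂ lead xs)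
            ≡⟨ e (H x) (∑ʳ (lead x) xs) (∑ᵒ (lead x) xs) (∑ᵒ H xs) (∑₂ lead xs) ⟩
          H x + ∑ᵒ H xs + (∑ʳ (lead x) xs + ∑ᵒ (lead x) xs + ∑₂ lead xs)
            ≡⟨ cong₂ (λ s t → s + (t + ∑₂ lead xs)) (∑ᵒ-o H xs rx) (∑-split (lead x) xs) ⟨
          ∑ᵒ H (x ∷ xs) + (∑ (lead x) xs + ∑₂ lead xs) ∎
          where
          open ≡-Reasoning
          e : ∀ a b c d e → a + b + c + (d + e) ≡ a + d + (b + c + e)
          e = solve-∀

    bound : List A → ℕ × ℕ
    bound xs = ∑ (λ x → p x * w x) xs + ∑₂ pair xs , rented xs

    bound≼cost : ∀ {xs} → xs ↭ J → bound xs ≼ (weighted xs , span false xs)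
    bound≼cost {xs} xs↭J = +-mono (≤⇒≼ ≤-refl (≤-refl {0}))
      (≼-trans (≡⇒≼ (cong (_+ ∑₂ pair xs) (zeros (λ _ → refl))) refl)
      (≼-trans (pairs≼ [] xs (λ f → ∑-↭ (onʳ f) (↭-sym xs↭J)))
        (≡⇒≼ (cong (_+ ∑₂ lead xs) (sym (zeros (λ o → *-zeroʳ (w o))))) refl)))
      where
      zeros : ∀ {f} → (∀ x → f x ≡ 0) → 0 ≡ ∑ᵒ f xs
      zeros {f} f≗0 = sym (go xs)
        where
        go : ∀ zs → ∑ᵒ f zs ≡ 0
        go []       = refl
        go (z ∷ zs) with r z
        ... | true  = go zs
        ... | false = cong₂ _+_ (f≗0 z) (go zs)

    -- Attaining the bound

    Precedes : A → A → Set
    Precedes x y = (rank (class x) ≤ rank (class y)) × (class x ≡ class y → x ⊵ y)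

    rank-injective : ∀ {c d} → rank c ≡ rank d → c ≡ d
    rank-injective {before} {before} _ = refl
    rank-injective {inside} {inside} _ = refl
    rank-injective {after}  {after}  _ = refl

    lead≤pair : ∀ {x y} → Precedes x y → lead x y ≤ pair x y
    lead≤pair {x} {y} (le , same⇒⊵) with r x | r y
    ... | true  | true  = ≤-reflexive (sym (⊵⇒least (same⇒⊵ refl)))
    ... | true  | false with classᵒ y
    ...   | inside = ≤-reflexive (trans (sym (⊵⇒least (same⇒⊵ refl))) (least-sym x y))
    ...   | after  = ≤-reflexive (*-comm (p x) (w y))
    lead≤pair {x} {y} (le , same⇒⊵) | false | true with classᵒ x
    ...   | before = ≤-refl
    ...   | inside = ≤-reflexive (sym (⊵⇒least (same⇒⊵ refl)))
    ...   | after  with s≤s () ← le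
    lead≤pair {x} {y} (le , same⇒⊵) | false | false = ≤-reflexive (sym (⊵⇒least sorted))
      where
      sorted : x ⊵ y
      sorted with ⊵-total x y
      ... | inj₁ x⊵y = x⊵y
      -- If `y` has the larger ratio, monotonicity of the rank forces equal classes, and within a
      -- class the order is by ratio.
      ... | inj₂ y⊵x = same⇒⊵ (rank-injective (≤-antisym le (rank-monoᵒ y⊵x)))

    -- A job outside `Jʳ` is rented only with r-jobs on both sides. The earlier one excludes the
    -- class `before`, the later one `after`; hence it is `inside` and has been charged.
    span≤rented : ∀ b {xs} → AllPairs Precedes xs → (b ≡ true → All (λ x → class x ≢ before) xs) →
                  span b xs ≤ rented xs
    span≤rented b []                     _    = z≤n
    span≤rented b (_∷_ {x} {xs} prec precs) seen =
      +-mono-≤ (counted b (any r xs) (λ b≡t → All.head (seen b≡t)) (any⇒rank prec))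
               (span≤rented (r x ∨ b) precs seen′)
      where
      any⇒rank : ∀ {xs} → All (Precedes x) xs → any r xs ≡ true → rank (class x) ≤ 1
      any⇒rank {y ∷ _} ((le , _) ∷ prec) eq with r y
      ... | true  = le
      ... | false = any⇒rank prec eq
      counted : ∀ b c → (b ≡ true → class x ≢ before) → (c ≡ true → rank (class x) ≤ 1) →
                (if r x ∨ (b ∧ c) then p x else 0) ≤ weight (class x) x
      counted b c started unfinished with r x
      ... | true = ≤-refl
      counted false _     _       _          | false = z≤n
      counted true  false _       _          | false = z≤n
      counted true  true  started unfinished | false with classᵒ x
      ... | before = contradiction refl (started refl)
      ... | inside = ≤-refl
      ... | after  with s≤s () ← unfinished refl
      seen′ : r x ∨ b ≡ true → All (λ y → class y ≢ before) xs
      seen′ eq with r x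
      ... | true  = All.map (λ { (le , _) eq → contradiction (subst (λ c → 1 ≤ rank c) eq le) λ () }) prec
      ... | false = All.tail (seen eq)

    cost≼bound : ∀ {xs} → AllPairs Precedes xs → (weighted xs , span false xs) ≼ bound xs
    cost≼bound {xs} precs = ≤⇒≼ (+-monoʳ-≤ (∑ (λ x → p x * w x) xs) (∑₂-mono (AllPairs.map lead≤pair precs)))
                                (span≤rented false precs λ ())

    bound-↭ : ∀ {xs ys} → xs ↭ ys → bound xs ≡ bound ys
    bound-↭ xs↭ys = cong₂ _,_ (cong₂ _+_ (∑-↭ _ xs↭ys) (∑₂-↭ pair-sym xs↭ys)) (∑-↭ _ xs↭ys)

    optimal : ∀ {xs ys} → xs ↭ J → ys ↭ J → AllPairs Precedes xs →
              (weighted xs , span false xs) ≼ (weighted ys , span false ys)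
    optimal {ys = ys} xs↭J ys↭J precs = ≼-trans (cost≼bound precs)
      (subst (_≼ (weighted ys , span false ys)) (bound-↭ (↭-trans ys↭J (↭-sym xs↭J))) (bound≼cost ys↭J))

    -- Prefix sums and the arrangement by classes

    -- The r-jobs before x in ratio order contribute w x * p y to M x, the others p x * w y.
    prefix-M : ∀ {ys xs x} → Split ys xs → All (_⊵ x) ys → All (x ⊵_) xs →
               M x ≡ w x * ∑ʳ p ys + p x * ∑ʳ w xs
    prefix-M {ys} {xs} {x} split ys⊵x x⊵xs = trans (split (least x)) (cong₂ _+_
      (trans (local (All.map (λ {y} y⊵x → trans (least-sym x y) (trans (⊵⇒least y⊵x) (*-comm (p y) (w x)))) ys⊵x))
             (∑ʳ-* (w x) p ys))
      (trans (local (All.map ⊵⇒least x⊵xs)) (∑ʳ-* (p x) w xs)))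
      where
      local : ∀ {f g zs} → All (λ z → f z ≡ g z) zs → ∑ʳ f zs ≡ ∑ʳ g zs
      local {f} {g} eqs = cong sum (map-cong-local (All.map pointwise eqs))
        where
        pointwise : ∀ {z} → f z ≡ g z → onʳ f z ≡ onʳ g z
        pointwise {z} = cong (λ n → if r z then n else 0)

    ofRank : ℕ → List A → List A
    ofRank k = filter (λ x → rank (class x) ≟ k)

    arrange : List A → List A
    arrange xs = ofRank 0 xs ++ ofRank 1 xs ++ ofRank 2 xs

    arrange-↭ : ∀ xs → arrange xs ↭ xs
    arrange-↭ []       = Perm.refl
    arrange-↭ (x ∷ xs) with class x
    ... | before = Perm.prep x (arrange-↭ xs)
    ... | inside = ↭-trans (shift x (ofRank 0 xs) _) (Perm.prep x (arrange-↭ xs))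
    ... | after  = ↭-trans (++⁺ˡ (ofRank 0 xs) (shift x (ofRank 1 xs) _))
                     (↭-trans (shift x (ofRank 0 xs) _) (Perm.prep x (arrange-↭ xs)))

    arrange-precedes : ∀ {xs} → AllPairs _⊵_ xs → AllPairs Precedes (arrange xs)
    arrange-precedes {xs} ⊵xs =
      ++⁺ (within 0) (++⁺ (within 1) (within 2) (between {1} {2} ≤-refl))
          (All.map (λ (lt₁ , lt₂) → All.++⁺ lt₁ lt₂) (All.zip (between {0} {1} ≤-refl , between {0} {2} (s≤s z≤n))))
      where

      same-rank : ∀ {k zs} → AllPairs _⊵_ zs → All (λ x → rank (class x) ≡ k) zs → AllPairs Precedes zs
      same-rank []         []         = []
      same-rank (z⊵ ∷ ⊵zs) (eq ∷ eqs) =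
        All.zipWith (λ (z⊵y , eq′) → ≤-reflexive (trans eq (sym eq′)) , λ _ → z⊵y) (z⊵ , eqs) ∷ same-rank ⊵zs eqs
      ranks : ∀ k → All (λ x → rank (class x) ≡ k) (ofRank k xs)
      ranks k = All.all-filter (λ x → rank (class x) ≟ k) xs
      within : ∀ k → AllPairs Precedes (ofRank k xs)
      within k = same-rank (filter⁺ (λ x → rank (class x) ≟ k) ⊵xs) (ranks k)
      between : ∀ {k l} → k < l → All (λ x → All (Precedes x) (ofRank l xs)) (ofRank k xs)
      between {k} {l} k<l = All.map (λ eq → All.map (λ eq′ →
        ≤-trans (≤-reflexive eq) (≤-trans (<⇒≤ k<l) (≤-reflexive (sym eq′))) ,
        λ same → contradiction (trans (sym eq) (trans (cong rank same) eq′)) (<⇒≢ k<l)) (ranks l)) (ranks k)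

    arrange-sort-optimal : ∀ {τ} → τ ↭ J → (weighted (arrange (sort J)) , span false (arrange (sort J))) ≼
                                           (weighted τ , span false τ)
    arrange-sort-optimal τ↭J = optimal (↭-trans (arrange-↭ (sort J)) (sort-↭ J)) τ↭J (arrange-precedes (sort-⊵ J))

-- From completion times and `er` to the pairwise form

module JobProperties {n : ℕ} (I : Jobs n) where
  open Jobs I

  inJʳ : Fin n → Bool
  inJʳ j = does (j ∈? Jʳ)

  open Scheduling p w inJʳ p-nonZero

  private
    C : List (Fin n) → Fin n → ℕ
    C = completion I

  completion-head : ∀ i σ → C (i ∷ σ) i ≡ p i
  completion-head i σ rewrite dec-true (i Fin.≟ i) refl = refl

  completion-tail : ∀ {i j} σ → i ≢ j → C (i ∷ σ) j ≡ p i + C σ j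
  completion-tail {i} {j} σ i≢j rewrite dec-false (i Fin.≟ j) i≢j = refl

  -- The head delays each later job `j` by `p i`, which adds `lead i j`. Uniqueness keeps
  -- `completion` from stopping at the head for a later job.
  ∑-completion : ∀ {σ} → Unique σ → ∑ (λ j → w j * C σ j) σ ≡ weighted σ
  ∑-completion []                         = refl
  ∑-completion {i ∷ σ} (i∉σ ∷ uniq) = begin
    w i * C (i ∷ σ) i + ∑ (λ j → w j * C (i ∷ σ) j) σ
      ≡⟨ cong₂ _+_ (trans (cong (w i *_) (completion-head i σ)) (*-comm (w i) (p i)))
                   (cong sum (map-cong-local (All.map (λ {j} i≢j →
                     trans (cong (w j *_) (completion-tail σ i≢j)) (e₁ (w j) (p i) (C σ j))) i∉σ))) ⟩
    p i * w i + ∑ (λ j → lead i j + w j * C σ j) σ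
      ≡⟨ cong (p i * w i +_) (∑-+ (lead i) _ σ) ⟩
    p i * w i + (∑ (lead i) σ + ∑ (λ j → w j * C σ j) σ)
      ≡⟨ cong (λ s → p i * w i + (∑ (lead i) σ + s)) (∑-completion uniq) ⟩
    p i * w i + (∑ (lead i) σ + (∑ (λ x → p x * w x) σ + ∑₂ lead σ))
      ≡⟨ e₂ (p i * w i) (∑ (lead i) σ) (∑ (λ x → p x * w x) σ) (∑₂ lead σ) ⟩
    weighted (i ∷ σ) ∎
    where
    open ≡-Reasoning
    e₁ : ∀ a b c → a * (b + c) ≡ b * a + a * c
    e₁ = solve-∀
    e₂ : ∀ a b c d → a + (b + (c + d)) ≡ a + c + (b + d)
    e₂ = solve-∀

  Sequence⇒Unique : ∀ {σ} → Sequence I σ → Unique σ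
  Sequence⇒Unique σ↭ = Unique-resp-↭ (setoid _) (Perm.↭⇒↭ₛ (↭-sym σ↭)) (allFin⁺ n)

  weightedCompletion≡weighted : ∀ {σ} → Sequence I σ → weightedCompletion I σ ≡ weighted σ
  weightedCompletion≡weighted {σ} σ↭ = trans (∑-↭ (λ j → w j * C σ j) (↭-sym σ↭)) (∑-completion (Sequence⇒Unique σ↭))

  -- Recursive forms of the minimum and maximum in `er`, valid once an r-job occurs. Without one
  -- they are the total processing time and 0.
  rentStart rentEnd : List (Fin n) → ℕ
  rentStart []      = 0
  rentStart (i ∷ σ) = if inJʳ i then 0 else p i + rentStart σ
  rentEnd []      = 0
  rentEnd (i ∷ σ) = if any inJʳ σ then p i + rentEnd σ else (if inJʳ i then p i else 0)

  any-∈ : ∀ {j σ} → j ∈ σ → inJʳ j ≡ true → any inJʳ σ ≡ true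
  any-∈ (here refl) rj rewrite rj = refl
  any-∈ {j} {i ∷ σ} (there j∈σ) rj with inJʳ i
  ... | true  = refl
  ... | false = any-∈ j∈σ rj

  rentEnd-none : ∀ σ → any inJʳ σ ≡ false → rentEnd σ ≡ 0
  rentEnd-none []      _ = refl
  rentEnd-none (i ∷ σ) none with inJʳ i
  ... | false rewrite none = refl

  -- With an r-job already behind, the renting lasts from the start of the list to its last r-job.
  span-true : ∀ σ → span true σ ≡ rentEnd σ
  span-true []      = refl
  span-true (i ∷ σ) with inJʳ i | any inJʳ σ in eq
  ... | true  | true  = cong (p i +_) (span-true σ)
  ... | true  | false = trans (cong (p i +_) (trans (span-true σ) (rentEnd-none σ eq))) (+-identityʳ (p i))
  ... | false | true  = cong (p i +_) (span-true σ)
  ... | false | false = trans (span-true σ) (rentEnd-none σ eq)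

  rentStart+span : ∀ σ → any inJʳ σ ≡ true → rentStart σ + span false σ ≡ rentEnd σ
  rentStart+span (i ∷ σ) some with inJʳ i
  ... | true with any inJʳ σ in eq
  ...   | true  = cong (p i +_) (span-true σ)
  ...   | false = trans (cong (p i +_) (trans (span-true σ) (rentEnd-none σ eq))) (+-identityʳ (p i))
  rentStart+span (i ∷ σ) some | false rewrite some =
    trans (+-assoc (p i) (rentStart σ) (span false σ)) (cong (p i +_) (rentStart+span σ some))

  -- Adding `p j` on the left avoids the truncated subtraction in `start`.
  rentStart-≤ : ∀ {j σ} → j ∈ σ → inJʳ j ≡ true → rentStart σ + p j ≤ C σ j
  rentStart-≤ {j} {i ∷ σ} j∈ rj with i Fin.≟ j
  ... | yes refl rewrite rj = ≤-refl
  rentStart-≤ (here refl)   rj | no i≢j = contradiction refl i≢j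
  rentStart-≤ {j} {i ∷ σ} (there j∈σ) rj | no i≢j with inJʳ i
  ... | true  = ≤-trans (m≤n+m (p j) (rentStart σ)) (≤-trans (rentStart-≤ j∈σ rj) (m≤n+m _ (p i)))
  ... | false = ≤-trans (≤-reflexive (+-assoc (p i) (rentStart σ) (p j))) (+-monoʳ-≤ (p i) (rentStart-≤ j∈σ rj))

  rentEnd-≥ : ∀ {j σ} → j ∈ σ → inJʳ j ≡ true → C σ j ≤ rentEnd σ
  rentEnd-≥ {j} {i ∷ σ} j∈ rj with i Fin.≟ j
  ... | yes refl rewrite rj with any inJʳ σ
  ...   | true  = m≤m+n (p i) _
  ...   | false = ≤-refl
  rentEnd-≥ (here refl)   rj | no i≢j = contradiction refl i≢j
  rentEnd-≥ {j} {i ∷ σ} (there j∈σ) rj | no i≢j rewrite any-∈ j∈σ rj = +-monoʳ-≤ (p i) (rentEnd-≥ j∈σ rj)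

  rentStart-attained : ∀ {σ} → Unique σ → any inJʳ σ ≡ true →
                       ∃[ j ] inJʳ j ≡ true × C σ j ≤ rentStart σ + p j
  rentStart-attained {i ∷ σ} (i∉σ ∷ uniq) some with inJʳ i in ri
  ... | true  = i , ri , ≤-reflexive (completion-head i σ)
  ... | false with rentStart-attained uniq some
  ...   | j , rj , le = j , rj , (begin
    C (i ∷ σ) j               ≡⟨ completion-tail σ (λ { refl → contradiction (trans (sym ri) rj) λ () }) ⟩
    p i + C σ j               ≤⟨ +-monoʳ-≤ (p i) le ⟩
    p i + (rentStart σ + p j) ≡⟨ +-assoc (p i) (rentStart σ) (p j) ⟨
    p i + rentStart σ + p j   ∎)
    where open ≤-Reasoning

  rentEnd-attained : ∀ {σ} → Unique σ → any inJʳ σ ≡ true →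
                     ∃[ j ] j ∈ σ × inJʳ j ≡ true × rentEnd σ ≤ C σ j
  rentEnd-attained {i ∷ σ} (i∉σ ∷ uniq) some with any inJʳ σ in eq
  ... | true with rentEnd-attained uniq eq
  ...   | j , j∈σ , rj , le = j , there j∈σ , rj ,
    ≤-trans (+-monoʳ-≤ (p i) le) (≤-reflexive (sym (completion-tail σ (All.lookup i∉σ j∈σ))))
  rentEnd-attained {i ∷ σ} (i∉σ ∷ uniq) some | false with inJʳ i in ri
  ... | true = i , here refl , ri , ≤-reflexive (sym (completion-head i σ))
  rentEnd-attained {i ∷ σ} (i∉σ ∷ uniq) () | false | false

  rentStart≤∑p : ∀ σ → rentStart σ ≤ ∑ p σ
  rentStart≤∑p []      = z≤n
  rentStart≤∑p (i ∷ σ) with inJʳ i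
  ... | true  = z≤n
  ... | false = +-monoʳ-≤ (p i) (rentStart≤∑p σ)

  ∈-rJobs : ∀ {j} → inJʳ j ≡ true → j ∈ rJobs I
  ∈-rJobs {j} rj with j ∈? Jʳ in eq
  ... | yes j∈Jʳ = ∈-filter⁺ (_∈? Jʳ) (∈-allFin j) j∈Jʳ

  er≡span : ∀ {σ} → Sequence I σ → er I σ ≡ span false σ
  er≡span {σ} σ↭ = begin
    er I σ                        ≡⟨ cong₂ _∸_ (≤-antisym last≤ ≤last) (≤-antisym first≤ ≤first) ⟩
    rentEnd σ ∸ rentStart σ       ≡⟨ cong (_∸ rentStart σ) (rentStart+span σ some) ⟨
    rentStart σ + span false σ ∸ rentStart σ ≡⟨ m+n∸m≡n (rentStart σ) _ ⟩
    span false σ                  ∎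
    where
    open ≡-Reasoning
    uniq : Unique σ
    uniq = Sequence⇒Unique σ↭
    in-σ : ∀ j → j ∈ σ
    in-σ j = ∈-resp-↭ (↭-sym σ↭) (∈-allFin j)
    some : any inJʳ σ ≡ true
    some = any-∈ (in-σ (proj₁ nonempty)) (dec-true (_ ∈? Jʳ) (proj₂ nonempty))
    r-all : All (λ j → inJʳ j ≡ true) (rJobs I)
    r-all = All.map (λ {j} → dec-true (j ∈? Jʳ)) (All.all-filter (_∈? Jʳ) (allFin n))
    last≤ : max 0 (map (C σ) (rJobs I)) ≤ rentEnd σ
    last≤ = max≤v⁺ z≤n (All.map⁺ (All.map (λ {j} → rentEnd-≥ (in-σ j)) r-all))
    ≤last : rentEnd σ ≤ max 0 (map (C σ) (rJobs I))
    ≤last with rentEnd-attained uniq some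
    ... | j , _ , rj , le = v≤max⁺ 0 _ (inj₂ (Any.map⁺ (Any.map (λ { refl → le }) (∈-rJobs rj))))
    first≤ : min (∑ p (allFin n)) (map (start I σ) (rJobs I)) ≤ rentStart σ
    first≤ with rentStart-attained uniq some
    ... | j , rj , le = min≤v⁺ (∑ p (allFin n)) _ (inj₂ (Any.map⁺ (Any.map
      (λ { refl → m≤n+o⇒m∸n≤o _ (p j) (≤-trans le (≤-reflexive (+-comm (rentStart σ) (p j)))) }) (∈-rJobs rj))))
    ≤first : rentStart σ ≤ min (∑ p (allFin n)) (map (start I σ) (rJobs I))
    -- The default value of `min`, the total processing time, must respect the bound as well.
    ≤first = v≤min⁺ (≤-trans (rentStart≤∑p σ) (≤-reflexive (∑-↭ p σ↭)))
      (All.map⁺ (All.map (λ {j} rj → m+n≤o⇒m≤o∸n (rentStart σ) (rentStart-≤ (in-σ j) rj)) r-all))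

-- Naturals in an ordered ring and the order of costs

module OrderedRingProperties {c ℓ₁ ℓ₂} (K : OrderedCommutativeRing c ℓ₁ ℓ₂) where
  open OrderedCommutativeRing K public
    using (Carrier; _≈_; 0#; 1#; -_; fromℕ; isDecTotalOrder; *-nonNeg; 0≉1)
    renaming (_+_ to _+ᴷ_; _*_ to _*ᴷ_; _-_ to _-ᴷ_; _≤_ to _≤ᴷ_)
  module R = OrderedCommutativeRing K
  module ≤ᴷ = IsDecTotalOrder isDecTotalOrder
  open import Algebra.Properties.Semiring.Mult R.semiring using (×-homo-+; ×1-homo-*)
  open import Algebra.Properties.Ring R.ring using (-‿distribˡ-*; -‿involutive)
  open import Relation.Binary.Reasoning.Setoid R.setoid

  ≤ᴷ-resp : ∀ {x x′ y y′} → x ≈ x′ → y ≈ y′ → x ≤ᴷ y → x′ ≤ᴷ y′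
  ≤ᴷ-resp x≈x′ y≈y′ x≤y = ≤ᴷ.trans (≤ᴷ.reflexive (R.sym x≈x′)) (≤ᴷ.trans x≤y (≤ᴷ.reflexive y≈y′))

  +-mono-≤ᴷ : ∀ {x y u v} → x ≤ᴷ y → u ≤ᴷ v → x +ᴷ u ≤ᴷ y +ᴷ v
  +-mono-≤ᴷ {x} {y} {u} {v} x≤y u≤v =
    ≤ᴷ.trans (R.+-monoˡ-≤ u x≤y) (≤ᴷ-resp (R.+-comm u y) (R.+-comm v y) (R.+-monoˡ-≤ y u≤v))

  +-cancelˡ-≤ᴷ : ∀ z {x y} → z +ᴷ x ≤ᴷ z +ᴷ y → x ≤ᴷ y
  +-cancelˡ-≤ᴷ z le = ≤ᴷ-resp (cancel _) (cancel _) (R.+-monoˡ-≤ (- z) le)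
    where
    cancel : ∀ x → z +ᴷ x +ᴷ - z ≈ x
    cancel x = begin
      z +ᴷ x +ᴷ - z   ≈⟨ R.+-congʳ (R.+-comm z x) ⟩
      x +ᴷ z +ᴷ - z   ≈⟨ R.+-assoc x z (- z) ⟩
      x +ᴷ (z +ᴷ - z) ≈⟨ R.+-congˡ (R.-‿inverseʳ z) ⟩
      x +ᴷ 0#         ≈⟨ R.+-identityʳ x ⟩
      x               ∎

  0≤1 : 0# ≤ᴷ 1#
  0≤1 with ≤ᴷ.total 0# 1#
  ... | inj₁ 0≤1 = 0≤1
  ... | inj₂ 1≤0 = ≤ᴷ-resp R.refl square (*-nonNeg 0≤-1 0≤-1)
    where
    0≤-1 : 0# ≤ᴷ - 1#
    0≤-1 = ≤ᴷ-resp (R.-‿inverseʳ 1#) (R.+-identityˡ _) (R.+-monoˡ-≤ (- 1#) 1≤0)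
    square : - 1# *ᴷ - 1# ≈ 1#
    square = begin
      - 1# *ᴷ - 1#     ≈⟨ -‿distribˡ-* 1# (- 1#) ⟨
      - (1# *ᴷ - 1#)   ≈⟨ R.-‿cong (R.*-identityˡ (- 1#)) ⟩
      - (- 1#)         ≈⟨ -‿involutive 1# ⟩
      1#               ∎

  fromℕ-+ : ∀ a b → fromℕ (a + b) ≈ fromℕ a +ᴷ fromℕ b
  fromℕ-+ = ×-homo-+ 1#

  fromℕ-* : ∀ a b → fromℕ (a * b) ≈ fromℕ a *ᴷ fromℕ b
  fromℕ-* = ×1-homo-*

  fromℕ-nonNeg : ∀ a → 0# ≤ᴷ fromℕ a
  fromℕ-nonNeg zero    = ≤ᴷ.refl
  fromℕ-nonNeg (suc a) = ≤ᴷ-resp (R.+-identityˡ 0#) R.refl (+-mono-≤ᴷ 0≤1 (fromℕ-nonNeg a))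

  fromℕ-mono : ∀ {a b} → a ≤ b → fromℕ a ≤ᴷ fromℕ b
  fromℕ-mono {b = b} z≤n = fromℕ-nonNeg b
  fromℕ-mono (s≤s a≤b)   = +-mono-≤ᴷ ≤ᴷ.refl (fromℕ-mono a≤b)

  -- Lets comparisons made by the program decide inequalities of naturals. A positive number below
  -- zero would give `1# ≤ 0#`, and then `0# ≈ 1#` by antisymmetry.
  fromℕ-cancel : ∀ {a b} → fromℕ a ≤ᴷ fromℕ b → a ≤ b
  fromℕ-cancel {zero}          le = z≤n
  fromℕ-cancel {suc a} {zero}  le = contradiction
    (≤ᴷ.antisym 0≤1 (≤ᴷ.trans (≤ᴷ-resp (R.+-identityʳ 1#) R.refl (+-mono-≤ᴷ ≤ᴷ.refl (fromℕ-nonNeg a))) le)) 0≉1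
  fromℕ-cancel {suc a} {suc b} le = s≤s (fromℕ-cancel (+-cancelˡ-≤ᴷ 1# le))

  module _ (rate : Carrier) (0≤rate : 0# ≤ᴷ rate) where

    value : ℕ × ℕ → Carrier
    value (a , c) = fromℕ a +ᴷ rate *ᴷ fromℕ c

    value-+ : ∀ a b c d → value (a + b , c + d) ≈ value (a , c) +ᴷ value (b , d)
    value-+ a b c d = begin
      fromℕ (a + b) +ᴷ rate *ᴷ fromℕ (c + d)
        ≈⟨ R.+-cong (fromℕ-+ a b) (R.trans (R.*-congˡ (fromℕ-+ c d)) (R.distribˡ rate _ _)) ⟩
      fromℕ a +ᴷ fromℕ b +ᴷ (rate *ᴷ fromℕ c +ᴷ rate *ᴷ fromℕ d)
        ≈⟨ interchange (fromℕ a) (fromℕ b) _ _ ⟩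
      value (a , c) +ᴷ value (b , d) ∎
      where open import Algebra.Properties.CommutativeSemigroup R.+-commutativeSemigroup using (interchange)

    value-mono : ∀ {a b c d} → a ≤ b → c ≤ d → value (a , c) ≤ᴷ value (b , d)
    value-mono {c = c} {d} a≤b c≤d = +-mono-≤ᴷ (fromℕ-mono a≤b) (≤ᴷ-resp (R.+-identityʳ _) (R.sym split)
      (+-mono-≤ᴷ (≤ᴷ.refl {rate *ᴷ fromℕ c}) (*-nonNeg 0≤rate (fromℕ-nonNeg (d ∸ c)))))
      where
      split : rate *ᴷ fromℕ d ≈ rate *ᴷ fromℕ c +ᴷ rate *ᴷ fromℕ (d ∸ c)
      split = begin
        rate *ᴷ fromℕ d             ≡⟨ cong (λ e → rate *ᴷ fromℕ e) (m+[n∸m]≡n c≤d) ⟨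
        rate *ᴷ fromℕ (c + (d ∸ c)) ≈⟨ R.trans (R.*-congˡ (fromℕ-+ c (d ∸ c))) (R.distribˡ rate _ _) ⟩
        rate *ᴷ fromℕ c +ᴷ rate *ᴷ fromℕ (d ∸ c) ∎

    infix 4 _≼_
    record _≼_ (x y : ℕ × ℕ) : Set ℓ₂ where
      constructor ⟨_⟩
      field
        value-≤ : value x ≤ᴷ value y

    costOrder : CostOrder ℓ₂
    costOrder = record
      { _≼_      = _≼_
      ; _≼?_     = λ x y → map′ ⟨_⟩ _≼_.value-≤ (value x ≤ᴷ.≤? value y)
      ; ≼-trans  = λ (⟨ x≤y ⟩) (⟨ y≤z ⟩) → ⟨ ≤ᴷ.trans x≤y y≤z ⟩
      ; ≼-total  = λ x y → Sum.map ⟨_⟩ ⟨_⟩ (≤ᴷ.total (value x) (value y))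
      ; ≤⇒≼      = λ a≤b c≤d → ⟨ value-mono a≤b c≤d ⟩
      ; +-mono   = mono
      ; +-cancel = cancel
      ; *-cancel = *-cancel
      }
      where
      mono : ∀ {a b c d a′ b′ c′ d′} → (a , c) ≼ (b , d) → (a′ , c′) ≼ (b′ , d′) →
             (a + a′ , c + c′) ≼ (b + b′ , d + d′)
      mono {a} {b} {c} {d} {a′} {b′} {c′} {d′} ⟨ le ⟩ ⟨ le′ ⟩ =
        ⟨ ≤ᴷ-resp (R.sym (value-+ a a′ c c′)) (R.sym (value-+ b b′ d d′)) (+-mono-≤ᴷ le le′) ⟩
      cancel : ∀ {a b c d} x y → (x + a , y + c) ≼ (x + b , y + d) → (a , c) ≼ (b , d)
      cancel {a} {b} {c} {d} x y ⟨ le ⟩ =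
        ⟨ +-cancelˡ-≤ᴷ (value (x , y)) (≤ᴷ-resp (value-+ x a y c) (value-+ x b y d) le) ⟩
      scale : ∀ {a b c d} k → (a , c) ≼ (b , d) → (k * a , k * c) ≼ (k * b , k * d)
      scale zero    le = ⟨ ≤ᴷ.refl ⟩
      scale (suc k) le = mono le (scale k le)
      *-cancel : ∀ {a b c d} k .{{_ : NonZero k}} → (k * a , k * c) ≼ (k * b , k * d) → (a , c) ≼ (b , d)
      *-cancel {a} {b} {c} {d} (suc k) (⟨ le ⟩) with ≤ᴷ.total (value (a , c)) (value (b , d))
      ... | inj₁ x≤y = ⟨ x≤y ⟩
      -- Without division: `(1 + k) x ≤ (1 + k) y = y + k y ≤ y + k x`, and `k x` cancels.
      ... | inj₂ y≤x = cancel (k * a) (k * c) (subst₂ _≼_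
              (cong₂ _,_ (+-comm a (k * a)) (+-comm c (k * c))) (cong₂ _,_ (+-comm b (k * a)) (+-comm d (k * c)))
              ⟨ ≤ᴷ.trans le (_≼_.value-≤ (mono {b} {b} {d} {d} ⟨ ≤ᴷ.refl ⟩ (scale k ⟨ y≤x ⟩))) ⟩)

-- The optimal schedule of an instance

module InstanceProperties {c ℓ₁ ℓ₂} {K : OrderedCommutativeRing c ℓ₁ ℓ₂} {n : ℕ} (I : Instance K n) where
  open Instance I
  open OrderedRingProperties K
  open JobProperties jobs public
  open Scheduling p w inJʳ p-nonZero public
  open Classes (costOrder rate 0≤rate) (allFin n) public

  schedule : List (Fin n)
  schedule = arrange (sort (allFin n))

  schedule-optimal : Optimal K I schedule
  schedule-optimal = seq , λ τ τ↭ → subst₂ _≤ᴷ_ (sym (cost≡ seq)) (sym (cost≡ τ↭))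
                                        (_≼_.value-≤ (arrange-sort-optimal τ↭))
    where
    seq : Sequence jobs schedule
    seq = ↭-trans (arrange-↭ (sort (allFin n))) (sort-↭ (allFin n))
    cost≡ : ∀ {σ} → Sequence jobs σ → cost K I σ ≡ value rate 0≤rate (weighted σ , span false σ)
    cost≡ σ↭ = cong₂ (λ a c → value rate 0≤rate (a , c)) (weightedCompletion≡weighted σ↭) (er≡span σ↭)

-- The program

pattern mergeᶠ      = 0F
pattern mergePairsᶠ = 1F
pattern mergeAllᶠ   = 2F
pattern singletonsᶠ = 3F
pattern total-pᶠ    = 4F
pattern total-wᶠ    = 5F
pattern selectᶠ     = 6F

arityᵖ : Fin 7 → ℕ
arityᵖ selectᶠ = 8
arityᵖ mergeᶠ  = 2
arityᵖ _       = 1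

E : ℕ → Set
E = Exp arityᵖ

-- A job does not end in `nil`: its flag is the third tail itself, so no head is taken.
headᵉ tailᵉ labelᵉ pᵉ wᵉ flagᵉ : ∀ {n} → E n → E n
headᵉ  e = case e nil (var 0F)
tailᵉ  e = case e nil (var 1F)
labelᵉ e = headᵉ e
pᵉ     e = headᵉ (tailᵉ e)
wᵉ     e = headᵉ (tailᵉ (tailᵉ e))
flagᵉ  e = tailᵉ (tailᵉ (tailᵉ e))

infixl 6 _⊕_ _⊝_
infixl 7 _⊗_
_⊕_ _⊝_ _⊗_ : ∀ {n} → E n → E n → E n
_⊕_ = op add
_⊝_ = op sub
_⊗_ = op mul

-- The rank of the class of job x, by prefix sums: P is the processing time of the r-jobs
-- before x in ratio order, W the weight of the other r-jobs, and Pʳ and Wʳ are the totals.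
rankᵉ : ∀ {n} (x P W Pʳ Wʳ rate : E n) → E n
rankᵉ x P W Pʳ Wʳ rate =
  ifle (lit 1) (flagᵉ x) (lit 1)
    (ifle early late (ifle early renting (lit 0) (lit 1)) (ifle late renting (lit 2) (lit 1)))
  where
  early late renting : E _
  early = pᵉ x ⊗ Wʳ
  late  = wᵉ x ⊗ Pʳ
  renting = wᵉ x ⊗ P ⊕ pᵉ x ⊗ W ⊕ rate ⊗ pᵉ x

-- The three merging functions follow the equations of the library's merge sort, whose correctness
-- then carries over to the computed lists.
bodyᵖ : (f : Fin 7) → E (arityᵖ f)
bodyᵖ mergeᶠ = case (var 0F) (var 1F) (case (var 3F) (var 2F)
  (ifle (pᵉ (var 2F) ⊗ wᵉ (var 0F)) (wᵉ (var 2F) ⊗ pᵉ (var 0F))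
    (cons (var 2F) (call mergeᶠ (var 3F ∷ var 5F ∷ [])))
    (cons (var 0F) (call mergeᶠ (var 4F ∷ var 1F ∷ [])))))
bodyᵖ mergePairsᶠ = case (var 0F) nil (case (var 1F) (var 2F)
  (cons (call mergeᶠ (var 2F ∷ var 0F ∷ [])) (call mergePairsᶠ (var 1F ∷ []))))
bodyᵖ mergeAllᶠ = case (var 0F) nil (case (var 1F) (var 0F)
  (call mergeAllᶠ (call mergePairsᶠ (var 4F ∷ []) ∷ [])))
bodyᵖ singletonsᶠ = case (var 0F) nil (cons (cons (var 0F) nil) (call singletonsᶠ (var 1F ∷ [])))
bodyᵖ total-pᶠ = case (var 0F) (lit 0) (flagᵉ (var 0F) ⊗ pᵉ (var 0F) ⊕ call total-pᶠ (var 1F ∷ []))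
bodyᵖ total-wᶠ = case (var 0F) (lit 0) (flagᵉ (var 0F) ⊗ wᵉ (var 0F) ⊕ call total-wᶠ (var 1F ∷ []))
-- With arguments k, xs, P, W, Pʳ, Wʳ, rate and v, the labels of the jobs of xs of rank k are
-- put in front of v.
bodyᵖ selectᶠ = case (var 1F) (var 7F)
  (letin (call selectᶠ (var 2F ∷ var 1F ∷ var 4F ⊕ flagᵉ (var 0F) ⊗ pᵉ (var 0F) ∷
                        var 5F ⊝ flagᵉ (var 0F) ⊗ wᵉ (var 0F) ∷ var 6F ∷ var 7F ∷ var 8F ∷ var 9F ∷ []))
  (letin (rankᵉ (var 1F) (var 5F) (var 6F) (var 7F) (var 8F) (var 9F))
  (ifle (var 0F) (var 4F) (ifle (var 4F) (var 0F) (cons (labelᵉ (var 2F)) (var 1F)) (var 1F)) (var 1F))))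

-- At first no r-job has been passed: `P` is 0 and `W` is the total `Wʳ`, so `var 0F` occurs twice.
-- Passing `rest` as the tail saves a separate concatenation; recomputing the ranks for each class
-- costs a constant factor.
selectᵉ : ℕ → E 5 → E 5
selectᵉ k rest = call selectᶠ (lit k ∷ var 2F ∷ lit 0 ∷ var 0F ∷ var 1F ∷ var 0F ∷ var 3F ∷ rest ∷ [])

program : Program
program = record
  { size  = 7
  ; arity = arityᵖ
  ; body  = bodyᵖ
  ; main  = letin (call mergeAllᶠ (call singletonsᶠ (var 1F ∷ []) ∷ []))
           (letin (call total-pᶠ (var 0F ∷ []))
           (letin (call total-wᶠ (var 1F ∷ []))
           (selectᵉ 0 (selectᵉ 1 (selectᵉ 2 nil)))))
  }

-- A merging round takes 36 per job, 15 per list and 12 for overhead. The linear part is 394 = 8 +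
-- 18 + 20 + 3 · 116: singletons, the two totals and three selections.
steps : ℕ → ℕ
steps n = suc ⌊log₂ n ⌋ * (n * 36 + n * 15 + 12) + n * 394 + 58

steps-O : O (λ n → n * ⌊log₂ n ⌋) steps
-- From n = 2 on the logarithm is at least 1, so every term is absorbed by the product: 578 = 51 +
-- 445 + 12 + 70.
steps-O = 578 , 2 , λ n 2≤n → bound n ⌊log₂ n ⌋ (≤-trans (s≤s z≤n) 2≤n)
  (≤-trans (≤-reflexive (sym (⌊log₂[2^n]⌋≡n 1))) (⌊log₂⌋-mono-≤ 2≤n))
  where
  open ≤-Reasoning
  expand : ∀ n l → suc l * (n * 36 + n * 15 + 12) + n * 394 + 58 ≡ 51 * (n * l) + 445 * n + 12 * l + 70
  expand = solve-∀
  collect : ∀ q → 51 * q + 445 * q + 12 * q + 70 * q ≡ 578 * q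
  collect = solve-∀
  bound : ∀ n l → 1 ≤ n → 1 ≤ l → suc l * (n * 36 + n * 15 + 12) + n * 394 + 58 ≤ 578 * (n * l)
  bound n@(suc _) l@(suc _) 1≤n 1≤l = begin
    suc l * (n * 36 + n * 15 + 12) + n * 394 + 58 ≡⟨ expand n l ⟩
    51 * (n * l) + 445 * n + 12 * l + 70
      ≤⟨ +-mono-≤ (+-mono-≤ (+-monoʳ-≤ (51 * (n * l)) (*-monoʳ-≤ 445 (m≤m*n n l))) (*-monoʳ-≤ 12 (m≤n*m l n)))
                  (*-monoʳ-≤ 70 (*-mono-≤ 1≤n 1≤l)) ⟩
    51 * (n * l) + 445 * (n * l) + 12 * (n * l) + 70 * (n * l) ≡⟨ collect (n * l) ⟩
    578 * (n * l) ∎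

-- Results and running times of the program

module Evaluation {c ℓ₁ ℓ₂} (K : OrderedCommutativeRing c ℓ₁ ℓ₂) where
  open OrderedRingProperties K

  infix 4 _⊢_⇓_at_ _⊢_⇓_within_ _⊢*_⇓_within_
  _⊢_⇓_at_ : ∀ {n} → Vec (Val K) n → E n → Val K → ℕ → Set _
  _⊢_⇓_at_ = _⊢_⇓_[_] K program

  record _⊢_⇓_within_ {n} (ρ : Vec (Val K) n) (e : E n) (v : Val K) (b : ℕ) : Set (c Level.⊔ ℓ₂) where
    constructor run
    field
      {time}     : ℕ
      derivation : ρ ⊢ e ⇓ v at time
      time≤      : time ≤ b

  record _⊢*_⇓_within_ {n k} (ρ : Vec (Val K) n) (es : Vec (E n) k) (vs : Vec (Val K) k)
                             (b : ℕ) : Set (c Level.⊔ ℓ₂) where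
    constructor run
    field
      {time}     : ℕ
      derivation : _⊢*_⇓_[_] K program ρ es vs time
      time≤      : time ≤ b

  module _ {n} {ρ : Vec (Val K) n} where

    exactly : ∀ {e v t} → ρ ⊢ e ⇓ v at t → ρ ⊢ e ⇓ v within t
    exactly d = run d ≤-refl

    weaken : ∀ {e v b b′} → b ≤ b′ → ρ ⊢ e ⇓ v within b → ρ ⊢ e ⇓ v within b′
    weaken b≤b′ (run d t≤b) = run d (≤-trans t≤b b≤b′)

    infixr 5 _∷ʷ_
    []ʷ : ρ ⊢* [] ⇓ [] within 0
    []ʷ = run [] z≤n

    _∷ʷ_ : ∀ {k e v b b′} {es : Vec (E n) k} {vs} →
           ρ ⊢ e ⇓ v within b → ρ ⊢* es ⇓ vs within b′ → ρ ⊢* e ∷ es ⇓ v ∷ vs within b + b′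
    run d t≤ ∷ʷ run ds ts≤ = run (d ∷ ds) (+-mono-≤ t≤ ts≤)

    callʷ : ∀ {f es vs v b b′} → ρ ⊢* es ⇓ vs within b → vs ⊢ bodyᵖ f ⇓ v within b′ →
            ρ ⊢ call f es ⇓ v within 1 + b + b′
    callʷ (run ds ts≤) (run d t≤) = run (call ds d) (s≤s (+-mono-≤ ts≤ t≤))

    letinʷ : ∀ {d e u v b b′} → ρ ⊢ d ⇓ u within b → u ∷ ρ ⊢ e ⇓ v within b′ →
             ρ ⊢ letin d e ⇓ v within 1 + b + b′
    letinʷ (run d t≤) (run e t≤′) = run (letin d e) (s≤s (+-mono-≤ t≤ t≤′))

    consʷ : ∀ {d e u v b b′} → ρ ⊢ d ⇓ u within b → ρ ⊢ e ⇓ v within b′ →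
            ρ ⊢ cons d e ⇓ cons u v within 1 + b + b′
    consʷ (run d t≤) (run e t≤′) = run (cons d e) (s≤s (+-mono-≤ t≤ t≤′))

    opʷ : ∀ {o d e x y b b′} → ρ ⊢ d ⇓ num x within b → ρ ⊢ e ⇓ num y within b′ →
          ρ ⊢ op o d e ⇓ num (⟦_⟧ K o x y) within 1 + b + b′
    opʷ (run d t≤) (run e t≤′) = run (op d e) (s≤s (+-mono-≤ t≤ t≤′))

    case-nilʷ : ∀ {d e f v t b} → ρ ⊢ d ⇓ nil at t → ρ ⊢ e ⇓ v within b →
                ρ ⊢ case d e f ⇓ v within 1 + t + b
    case-nilʷ {t = t} d (run e t≤) = run (case-nil d e) (s≤s (+-monoʳ-≤ t t≤))

    case-consʷ : ∀ {d e f x y v t b} → ρ ⊢ d ⇓ cons x y at t → x ∷ y ∷ ρ ⊢ f ⇓ v within b →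
                 ρ ⊢ case d e f ⇓ v within 1 + t + b
    case-consʷ {t = t} d (run e t≤) = run (case-cons d e) (s≤s (+-monoʳ-≤ t t≤))

    -- The branch is decided by a proposition `Q` equivalent to the comparison, so the result is the
    -- encoding `v` of a conditional on the specification side. Both branches share one bound.
    ifleʷ : ∀ {a b d e x y t u s q} {X : Set} (v : X → Val K) {l r} {Q : Set q} (Q? : Dec Q) →
            (Q → x ≤ᴷ y) → (x ≤ᴷ y → Q) → ρ ⊢ a ⇓ num x at t → ρ ⊢ b ⇓ num y at u →
            ρ ⊢ d ⇓ v l within s → ρ ⊢ e ⇓ v r within s →
            ρ ⊢ ifle a b d e ⇓ v (if does Q? then l else r) within 1 + t + u + s
    ifleʷ {t = t} {u} v (yes Q) to from a b (run d t≤) _ = run (ifle-yes a b (to Q) d) (s≤s (+-monoʳ-≤ (t + u) t≤))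
    ifleʷ {t = t} {u} v (no ¬Q) to from a b _ (run e t≤) = run (ifle-no a b (¬Q ∘ from) e) (s≤s (+-monoʳ-≤ (t + u) t≤))

    head⇓ : ∀ {e x y t} → ρ ⊢ e ⇓ cons x y at t → ρ ⊢ headᵉ e ⇓ x at 1 + t + 1
    head⇓ d = case-cons d var

    tail⇓ : ∀ {e x y t} → ρ ⊢ e ⇓ cons x y at t → ρ ⊢ tailᵉ e ⇓ y at 1 + t + 1
    tail⇓ d = case-cons d var

  module _ {n : ℕ} (I : Instance K n) where
    open Instance I using (rate; 0≤rate; p; w; Jʳ)
    open InstanceProperties I
    open CostOrder (costOrder rate 0≤rate) using (_≼?_)
    open MergeSortProperties byRatio using (mergePairs-↭)

    flag : Fin n → ℕ
    flag j = if inJʳ j then 1 else 0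

    module _ {k} {ρ : Vec (Val K) k} {e : E k} {j : Fin n} {t : ℕ} (e⇓ : ρ ⊢ e ⇓ job K I j at t) where

      p⇓ : ρ ⊢ pᵉ e ⇓ num (fromℕ (p j)) at _
      p⇓ = head⇓ (tail⇓ e⇓)

      w⇓ : ρ ⊢ wᵉ e ⇓ num (fromℕ (w j)) at _
      w⇓ = head⇓ (tail⇓ (tail⇓ e⇓))

      flag⇓ : ρ ⊢ flagᵉ e ⇓ num (fromℕ (flag j)) at _
      flag⇓ = tail⇓ (tail⇓ (tail⇓ e⇓))

    jobs : List (Fin n) → Val K
    jobs js = list K (map (job K I) js)

    jobss : List (List (Fin n)) → Val K
    jobss jss = list K (map jobs jss)

    -- An output job costs 36 = 4 + 27 + 5: two case distinctions, the ratio comparison, and the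
    -- cell with its recursive call.
    merge⇓ : ∀ is js → jobs is ∷ jobs js ∷ [] ⊢ bodyᵖ mergeᶠ ⇓ jobs (merge _⊵?_ is js)
                       within (length is + length js) * 36 + 5
    merge⇓ []       js       = weaken (≤-trans (m≤m+n 3 2) (m≤n+m 5 (length js * 36))) (case-nilʷ var (exactly var))
    merge⇓ (i ∷ is) []       = weaken (m≤n+m 5 ((suc (length is) + 0) * 36))
                                      (case-consʷ var (case-nilʷ var (exactly var)))
    merge⇓ (i ∷ is) (j ∷ js) =
      case-consʷ var (case-consʷ var
        (ifleʷ jobs (i ⊵? j) (≤ᴷ-resp (fromℕ-* (p i) (w j)) (fromℕ-* (w i) (p j)) ∘ fromℕ-mono)
               (fromℕ-cancel ∘ ≤ᴷ-resp (R.sym (fromℕ-* (p i) (w j))) (R.sym (fromℕ-* (w i) (p j))))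
               (op (p⇓ {e = var 2F} {i} var) (w⇓ {e = var 0F} {j} var))
               (op (w⇓ {e = var 2F} {i} var) (p⇓ {e = var 0F} {j} var))
          (consʷ (exactly var) (callʷ (exactly var ∷ʷ exactly var ∷ʷ []ʷ) (merge⇓ is (j ∷ js))))
          (weaken (≤-reflexive (cong (λ m → 5 + (m * 36 + 5)) (sym (+-suc (length is) (length js)))))
            (consʷ (exactly var) (callʷ (exactly var ∷ʷ exactly var ∷ʷ []ʷ) (merge⇓ (i ∷ is) js))))))

    mergePairs⇓ : ∀ jss → jobss jss ∷ [] ⊢ bodyᵖ mergePairsᶠ ⇓ jobss (mergePairs jss)
                          within length (concat jss) * 36 + length jss * 15 + 5
    mergePairs⇓ []               = weaken (m≤m+n 3 2) (case-nilʷ var (exactly nil))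
    mergePairs⇓ (is ∷ [])        = weaken (m≤n+m 5 _) (case-consʷ var (case-nilʷ var (exactly var)))
    mergePairs⇓ (is ∷ js ∷ jss) =
      -- Besides 36 per job, a pair of lists costs 15, while the bound grants 15 to each list; the
      -- surplus is given away.
      weaken (≤-trans (m≤n+m _ 15) (≤-reflexive (trans (e (length is) (length js) (length (concat jss)) (length jss))
               (cong (λ m → m * 36 + (2 + length jss) * 15 + 5) (sym lengths)))))
        (case-consʷ var (case-consʷ var
          (consʷ (callʷ (exactly var ∷ʷ exactly var ∷ʷ []ʷ) (merge⇓ is js))
                 (callʷ (exactly var ∷ʷ []ʷ) (mergePairs⇓ jss)))))
      where
      lengths : length (is ++ js ++ concat jss) ≡ length is + (length js + length (concat jss))
      lengths = trans (length-++ is) (cong (length is +_) (length-++ js))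
      e : ∀ i j m k → 15 + (5 + (3 + ((i + j) * 36 + 5) + (2 + (m * 36 + k * 15 + 5)))) ≡
                      (i + (j + m)) * 36 + (2 + k) * 15 + 5
      e = solve-∀

    mergePairs-halves : ∀ (jss : List (List (Fin n))) m → length jss ≤ m + m → length (mergePairs jss) ≤ m
    mergePairs-halves []              m       _  = z≤n
    mergePairs-halves (_ ∷ [])        (suc m) _  = s≤s z≤n
    mergePairs-halves (_ ∷ _ ∷ jss)   (suc m) (s≤s le) =
      s≤s (mergePairs-halves jss m (≤-pred (≤-trans le (≤-reflexive (+-suc m m)))))

    mergePairs-length : ∀ (jss : List (List (Fin n))) → length (mergePairs jss) ≤ length jss
    mergePairs-length jss = mergePairs-halves jss (length jss) (m≤m+n _ _)

    -- Induction on `e`: a round halves the bound `2 ^ e` on the number of lists. `m` and `k` stay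
    -- fixed, as a round keeps the jobs and never adds lists.
    mergeAll⇓ : ∀ m k e jss (rec : Acc _<_ (length jss)) →
                length (concat jss) ≤ m → length jss ≤ k → length jss ≤ 2 ^ e →
                jobss jss ∷ [] ⊢ bodyᵖ mergeAllᶠ ⇓ jobs (mergeAll jss rec) within e * (m * 36 + k * 15 + 12) + 5
    mergeAll⇓ m k e []        _ _ _ _ = weaken (≤-trans (m≤m+n 3 2) (m≤n+m 5 _)) (case-nilʷ var (exactly nil))
    mergeAll⇓ m k e (js ∷ []) _ _ _ _ = weaken (m≤n+m 5 _) (case-consʷ var (case-nilʷ var (exactly var)))
    mergeAll⇓ m k zero    (_ ∷ _ ∷ _) _ _ _ (s≤s ())
    mergeAll⇓ m k (suc e) jss@(is ∷ js ∷ jss′) (acc rec) ≤m ≤k ≤2^ =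
      weaken bound≤
        (case-consʷ var (case-consʷ var
          (callʷ (callʷ (exactly var ∷ʷ []ʷ) (mergePairs⇓ jss) ∷ʷ []ʷ)
            (mergeAll⇓ m k e (mergePairs jss) _
              (≤-trans (≤-reflexive (↭-length (mergePairs-↭ jss))) ≤m)
              (≤-trans (mergePairs-length jss) ≤k)
              (mergePairs-halves jss (2 ^ e) (≤-trans ≤2^ (≤-reflexive (cong (2 ^ e +_) (+-identityʳ _)))))))))
      where
      t : ℕ
      t = e * (m * 36 + k * 15 + 12) + 5
      bound≤ : 5 + (2 + (length (concat jss) * 36 + length jss * 15 + 5) + 0 + t) ≤
               m * 36 + k * 15 + 12 + e * (m * 36 + k * 15 + 12) + 5
      bound≤ = begin
        5 + (2 + (length (concat jss) * 36 + length jss * 15 + 5) + 0 + t)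
          ≤⟨ +-monoʳ-≤ 5 (+-monoˡ-≤ t (+-monoˡ-≤ 0
               (+-monoʳ-≤ 2 (+-monoˡ-≤ 5 (+-mono-≤ (*-monoˡ-≤ 36 ≤m) (*-monoˡ-≤ 15 ≤k)))))) ⟩
        5 + (2 + (m * 36 + k * 15 + 5) + 0 + t)
          ≡⟨ r (m * 36 + k * 15) (e * (m * 36 + k * 15 + 12)) ⟩
        m * 36 + k * 15 + 12 + e * (m * 36 + k * 15 + 12) + 5 ∎
        where
        open ≤-Reasoning
        r : ∀ a b → 5 + (2 + (a + 5) + 0 + (b + 5)) ≡ a + 12 + b + 5
        r = solve-∀

    singletons⇓ : ∀ js → jobs js ∷ [] ⊢ bodyᵖ singletonsᶠ ⇓ jobss (map [_] js) within length js * 8 + 3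
    singletons⇓ []       = case-nilʷ var (exactly nil)
    singletons⇓ (j ∷ js) = case-consʷ var
      (consʷ (exactly (cons var nil)) (callʷ (exactly var ∷ʷ []ʷ) (singletons⇓ js)))

    n<2^1+⌊log₂n⌋ : ∀ m → m < 2 ^ suc ⌊log₂ m ⌋
    n<2^1+⌊log₂n⌋ m = ≰⇒> λ le → 1+n≰n (subst (_≤ ⌊log₂ m ⌋) (⌊log₂[2^n]⌋≡n (suc ⌊log₂ m ⌋)) (⌊log₂⌋-mono-≤ le))

    sort⇓ : jobss (map [_] (allFin n)) ∷ [] ⊢ bodyᵖ mergeAllᶠ ⇓ jobs (sort (allFin n))
            within suc ⌊log₂ n ⌋ * (n * 36 + n * 15 + 12) + 5
    sort⇓ = mergeAll⇓ n n (suc ⌊log₂ n ⌋) (map [_] (allFin n)) _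
      (≤-reflexive (trans (cong length (concat-map-[ allFin n ])) n-jobs))
      (≤-reflexive singles)
      (≤-trans (≤-reflexive singles) (<⇒≤ (n<2^1+⌊log₂n⌋ n)))
      where
      n-jobs : length (allFin n) ≡ n
      n-jobs = length-tabulate id
      singles : length (map {B = List (Fin n)} [_] (allFin n)) ≡ n
      singles = trans (length-map [_] (allFin n)) n-jobs

    flag-* : ∀ f j → fromℕ (flag j) *ᴷ fromℕ (f j) ≈ fromℕ (onʳ f j)
    flag-* f j with inJʳ j
    ... | true  = R.trans (R.*-congʳ (R.+-identityʳ 1#)) (R.*-identityˡ _)
    ... | false = R.zeroˡ _

    -- Ring arithmetic yields the total only up to `≈`, hence the witness `x`.
    total-p⇓ : ∀ js → ∃[ x ] x ≈ fromℕ (∑ʳ p js) ×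
               (jobs js ∷ [] ⊢ bodyᵖ total-pᶠ ⇓ num x within length js * 18 + 3)
    total-p⇓ []       = 0# , R.refl , case-nilʷ var (exactly lit)
    total-p⇓ (j ∷ js) with total-p⇓ js
    ... | x , x≈ , x⇓ = _ , R.trans (R.+-cong (flag-* p j) x≈) (R.sym (fromℕ-+ (onʳ p j) _)) ,
      case-consʷ var (opʷ (opʷ (exactly (flag⇓ {e = var 0F} {j} var)) (exactly (p⇓ {e = var 0F} {j} var)))
                          (callʷ (exactly var ∷ʷ []ʷ) x⇓))

    total-w⇓ : ∀ js → ∃[ x ] x ≈ fromℕ (∑ʳ w js) ×
               (jobs js ∷ [] ⊢ bodyᵖ total-wᶠ ⇓ num x within length js * 20 + 3)
    total-w⇓ []       = 0# , R.refl , case-nilʷ var (exactly lit)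
    total-w⇓ (j ∷ js) with total-w⇓ js
    ... | x , x≈ , x⇓ = _ , R.trans (R.+-cong (flag-* w j) x≈) (R.sym (fromℕ-+ (onʳ w j) _)) ,
      case-consʷ var (opʷ (opʷ (exactly (flag⇓ {e = var 0F} {j} var)) (exactly (w⇓ {e = var 0F} {j} var)))
                          (callʷ (exactly var ∷ʷ []ʷ) x⇓))

    rankᵛ : Class → Val K
    rankᵛ c = num (fromℕ (rank c))

    module _ {j ys xs P W Pʳ′ Wʳ′} (split : Split ys xs) (ys⊵j : All (_⊵ j) ys) (j⊵xs : All (j ⊵_) xs)
             (P≈ : P ≈ fromℕ (∑ʳ p ys)) (W≈ : W ≈ fromℕ (∑ʳ w xs))
             (Pʳ≈ : Pʳ′ ≈ fromℕ Pʳ) (Wʳ≈ : Wʳ′ ≈ fromℕ Wʳ) where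

      private
        V : ℕ × ℕ → Carrier
        V = value rate 0≤rate

      before≈ : fromℕ (p j) *ᴷ Wʳ′ ≈ V (beforeCost j)
      before≈ = R.trans (R.*-congˡ Wʳ≈) (R.trans (R.sym (fromℕ-* (p j) Wʳ))
        (R.sym (R.trans (R.+-congˡ (R.zeroʳ rate)) (R.+-identityʳ _))))

      after≈ : fromℕ (w j) *ᴷ Pʳ′ ≈ V (afterCost j)
      after≈ = R.trans (R.*-congˡ Pʳ≈) (R.trans (R.sym (fromℕ-* (w j) Pʳ))
        (R.sym (R.trans (R.+-congˡ (R.zeroʳ rate)) (R.+-identityʳ _))))

      inside≈ : fromℕ (w j) *ᴷ P +ᴷ fromℕ (p j) *ᴷ W +ᴷ rate *ᴷ fromℕ (p j) ≈ V (insideCost j)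
      inside≈ = R.+-congʳ (R.trans (R.+-cong (R.*-congˡ P≈) (R.*-congˡ W≈))
        (R.sym (R.trans (R.reflexive (cong fromℕ (prefix-M {ys} {xs} split ys⊵j j⊵xs)))
          (R.trans (fromℕ-+ (w j * ∑ʳ p ys) (p j * ∑ʳ w xs))
            (R.+-cong (fromℕ-* (w j) (∑ʳ p ys)) (fromℕ-* (p j) (∑ʳ w xs)))))))

      -- Up to `≈`, the program compares the values that `classify` compares. The longest path takes
      -- 62 = 9 + 17 + 36; shorter branches are padded.
      rank⇓ : ∀ {k} {ρ : Vec (Val K) k} {x P′ W′ P″ W″ r : Fin k} →
              ρ ⊢ var x ⇓ job K I j at 1 → ρ ⊢ var P′ ⇓ num P at 1 → ρ ⊢ var W′ ⇓ num W at 1 →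
              ρ ⊢ var P″ ⇓ num Pʳ′ at 1 → ρ ⊢ var W″ ⇓ num Wʳ′ at 1 → ρ ⊢ var r ⇓ num rate at 1 →
              ρ ⊢ rankᵉ (var x) (var P′) (var W′) (var P″) (var W″) (var r) ⇓ rankᵛ (class j) within 62
      rank⇓ {x = x} x⇓ P⇓ W⇓ P″⇓ W″⇓ r⇓ =
        ifleʷ rankᵛ (j ∈? Jʳ) r⇒1≤ 1≤⇒r lit (flag⇓ {j = j} x⇓)
          (weaken (m≤m+n 1 52) (exactly lit))
          (ifleʷ rankᵛ (beforeCost j ≼? afterCost j)
                 (≤ᴷ-resp (R.sym before≈) (R.sym after≈) ∘ _≼_.value-≤) (⟨_⟩ ∘ ≤ᴷ-resp before≈ after≈) before⇓ after⇓
            (weaken (m≤m+n 34 2) (ifleʷ rankᵛ (beforeCost j ≼? insideCost j)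
                 (≤ᴷ-resp (R.sym before≈) (R.sym inside≈) ∘ _≼_.value-≤) (⟨_⟩ ∘ ≤ᴷ-resp before≈ inside≈) before⇓ inside⇓
              (exactly lit) (exactly lit)))
            (ifleʷ rankᵛ (afterCost j ≼? insideCost j)
                 (≤ᴷ-resp (R.sym after≈) (R.sym inside≈) ∘ _≼_.value-≤) (⟨_⟩ ∘ ≤ᴷ-resp after≈ inside≈) after⇓ inside⇓
              (exactly lit) (exactly lit)))
        where
        before⇓ = op {o = mul} (p⇓ {j = j} x⇓) W″⇓
        after⇓  = op {o = mul} (w⇓ {j = j} x⇓) P″⇓
        inside⇓ = op {o = add} (op {o = add} (op {o = mul} (w⇓ {j = j} x⇓) P⇓) (op {o = mul} (p⇓ {j = j} x⇓) W⇓))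
                     (op {o = mul} r⇓ (p⇓ {j = j} x⇓))
        r⇒1≤ : j ∈ˢ Jʳ → fromℕ 1 ≤ᴷ fromℕ (flag j)
        r⇒1≤ j∈ with j ∈? Jʳ
        ... | yes _  = ≤ᴷ.refl
        ... | no  j∉ = contradiction j∈ j∉
        1≤⇒r : fromℕ 1 ≤ᴷ fromℕ (flag j) → j ∈ˢ Jʳ
        1≤⇒r le with j ∈? Jʳ
        ... | yes j∈ = j∈
        ... | no  _  with () ← fromℕ-cancel {1} {0} le

    append : List (Val K) → Val K → Val K
    append us v = foldr cons v us

    -- `ys` holds the jobs already passed, none of smaller ratio than those to come, so `prefix-M`
    -- reads `M x` off the running sums.
    select⇓ : ∀ k v ys xs {P W Pʳ′ Wʳ′} → Split ys xs → All (λ x → All (_⊵ x) ys) xs → AllPairs _⊵_ xs →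
              P ≈ fromℕ (∑ʳ p ys) → W ≈ fromℕ (∑ʳ w xs) → Pʳ′ ≈ fromℕ Pʳ → Wʳ′ ≈ fromℕ Wʳ →
              num (fromℕ k) ∷ jobs xs ∷ num P ∷ num W ∷ num Pʳ′ ∷ num Wʳ′ ∷ num rate ∷ v ∷ []
                ⊢ bodyᵖ selectᶠ ⇓ append (map (label K) (ofRank k xs)) v within length xs * 116 + 3
    select⇓ k v ys []       _ _ _ _ _ _ _ = case-nilʷ var (exactly var)
    select⇓ k v ys (x ∷ xs) {P} {W} {Pʳ′} {Wʳ′} split (ys⊵x ∷ ys⊵xs) (x⊵xs ∷ ⊵xs) P≈ W≈ Pʳ≈ Wʳ≈ =
      weaken (≤-reflexive (reorder (length xs * 116 + 3)))
        (case-consʷ var (letinʷ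
          (callʷ (exactly var ∷ʷ exactly var ∷ʷ
                  opʷ (exactly var) (opʷ (exactly (flag⇓ {e = var 0F} {x} var)) (exactly (p⇓ {e = var 0F} {x} var))) ∷ʷ
                  opʷ (exactly var) (opʷ (exactly (flag⇓ {e = var 0F} {x} var)) (exactly (w⇓ {e = var 0F} {x} var))) ∷ʷ
                  exactly var ∷ʷ exactly var ∷ʷ exactly var ∷ʷ exactly var ∷ʷ []ʷ)
            (select⇓ k v (x ∷ ys) xs (Split-shift ys x xs split)
              (All.zipWith (λ (x⊵z , ys⊵z) → x⊵z ∷ ys⊵z) (x⊵xs , ys⊵xs)) ⊵xs P′≈ W′≈ Pʳ≈ Wʳ≈))
          -- The rank is taken before `x` joins the prefix: `x` still heads the suffix, hence
          -- `⊵-refl x`.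
          (letinʷ (rank⇓ {j = x} {ys} {x ∷ xs} split ys⊵x (⊵-refl x ∷ x⊵xs) P≈ W≈ Pʳ≈ Wʳ≈
                         {x = 1F} {5F} {6F} {7F} {8F} {9F} var var var var var var)
                  (exactly-rank? (rank (class x) ≟ k)))))
      where
      open import Relation.Binary.Reasoning.Setoid R.setoid
      reorder : ∀ m → 3 + (39 + m + 74) ≡ 116 + m
      reorder = solve-∀
      v′ : Val K
      v′ = append (map (label K) (ofRank k xs)) v
      P′≈ : P +ᴷ fromℕ (flag x) *ᴷ fromℕ (p x) ≈ fromℕ (∑ʳ p (x ∷ ys))
      P′≈ = begin
        P +ᴷ fromℕ (flag x) *ᴷ fromℕ (p x)        ≈⟨ R.+-cong P≈ (flag-* p x) ⟩
        fromℕ (∑ʳ p ys) +ᴷ fromℕ (onʳ p x)        ≈⟨ R.+-comm _ _ ⟩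
        fromℕ (onʳ p x) +ᴷ fromℕ (∑ʳ p ys)        ≈⟨ fromℕ-+ (onʳ p x) (∑ʳ p ys) ⟨
        fromℕ (∑ʳ p (x ∷ ys))                     ∎
      W′≈ : W -ᴷ fromℕ (flag x) *ᴷ fromℕ (w x) ≈ fromℕ (∑ʳ w xs)
      W′≈ = begin
        W +ᴷ - (fromℕ (flag x) *ᴷ fromℕ (w x))
          ≈⟨ R.+-cong (R.trans W≈ (R.trans (fromℕ-+ (onʳ w x) (∑ʳ w xs)) (R.+-comm _ _))) (R.-‿cong (flag-* w x)) ⟩
        fromℕ (∑ʳ w xs) +ᴷ fromℕ (onʳ w x) +ᴷ - fromℕ (onʳ w x)
          ≈⟨ R.+-assoc _ _ _ ⟩
        fromℕ (∑ʳ w xs) +ᴷ (fromℕ (onʳ w x) +ᴷ - fromℕ (onʳ w x))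
          ≈⟨ R.trans (R.+-congˡ (R.-‿inverseʳ _)) (R.+-identityʳ _) ⟩
        fromℕ (∑ʳ w xs) ∎
      -- Equality with `k` is tested by two opposite comparisons.
      exactly-rank? : Dec (rank (class x) ≡ k) →
        rankᵛ (class x) ∷ v′ ∷ job K I x ∷ jobs xs ∷ num (fromℕ k) ∷ jobs (x ∷ xs) ∷
           num P ∷ num W ∷ num Pʳ′ ∷ num Wʳ′ ∷ num rate ∷ v ∷ []
          ⊢ ifle (var 0F) (var 4F) (ifle (var 4F) (var 0F) (cons (labelᵉ (var 2F)) (var 1F)) (var 1F)) (var 1F)
          ⇓ append (map (label K) (ofRank k (x ∷ xs))) v within 11
      exactly-rank? (yes eq) rewrite filter-accept (λ x → rank (class x) ≟ k) {x} {xs} eq =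
        exactly (ifle-yes var var (≤ᴷ.reflexive (R.reflexive (cong fromℕ eq)))
          (ifle-yes var var (≤ᴷ.reflexive (R.reflexive (cong fromℕ (sym eq)))) (cons (head⇓ var) var)))
      exactly-rank? (no neq) rewrite filter-reject (λ x → rank (class x) ≟ k) {x} {xs} neq with rank (class x) ≤? k
      ... | yes le = run (ifle-yes var var (fromℕ-mono le)
                           (ifle-no var var (λ ge → neq (≤-antisym le (fromℕ-cancel ge))) var)) (m≤m+n 7 4)
      ... | no ≰   = run (ifle-no var var (≰ ∘ fromℕ-cancel) var) (m≤m+n 4 7)

    main⇓ : input K I ⊢ Program.main program ⇓ list K (map (label K) schedule) within steps n
    main⇓ with total-p⇓ (sort (allFin n)) | total-w⇓ (sort (allFin n))
    ... | x , x≈ , x⇓ | y , y≈ , y⇓ = subst₂ (λ v b → input K I ⊢ Program.main program ⇓ v within b) output≡ bound≡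
      (letinʷ (callʷ (callʷ (exactly var ∷ʷ []ʷ) (singletons⇓ (allFin n)) ∷ʷ []ʷ) sort⇓)
      (letinʷ (callʷ (exactly var ∷ʷ []ʷ) x⇓)
      (letinʷ (callʷ (exactly var ∷ʷ []ʷ) y⇓)
      (selected⇓ 0 (selected⇓ 1 (selected⇓ 2 (exactly nil)))))))
      where
      s : List (Fin n)
      s = sort (allFin n)
      Pʳ≈ : x ≈ fromℕ Pʳ
      Pʳ≈ = R.trans x≈ (R.reflexive (cong fromℕ (∑-↭ (onʳ p) (sort-↭ (allFin n)))))
      Wʳ≈ : y ≈ fromℕ Wʳ
      Wʳ≈ = R.trans y≈ (R.reflexive (cong fromℕ (∑-↭ (onʳ w) (sort-↭ (allFin n)))))
      selected⇓ : ∀ k {e v b} →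
        num y ∷ num x ∷ jobs s ∷ num rate ∷ jobs (allFin n) ∷ [] ⊢ e ⇓ v within b →
        num y ∷ num x ∷ jobs s ∷ num rate ∷ jobs (allFin n) ∷ [] ⊢ selectᵉ k e
          ⇓ append (map (label K) (ofRank k s)) v within _
      selected⇓ k {v = v} e⇓ = callʷ
        (exactly lit ∷ʷ exactly var ∷ʷ exactly lit ∷ʷ exactly var ∷ʷ exactly var ∷ʷ exactly var ∷ʷ exactly var ∷ʷ
         e⇓ ∷ʷ []ʷ)
        (select⇓ k v [] s (λ f → ∑-↭ (onʳ f) (Perm.↭-sym (sort-↭ (allFin n)))) (All.universal (λ _ → []) s)
          (sort-⊵ (allFin n)) R.refl y≈ Pʳ≈ Wʳ≈)
      output≡ : append (map (label K) (ofRank 0 s)) (append (map (label K) (ofRank 1 s))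
                  (append (map (label K) (ofRank 2 s)) nil)) ≡ list K (map (label K) schedule)
      output≡ = sym (trans (step (ofRank 0 s) _) (cong (append (map (label K) (ofRank 0 s))) (step (ofRank 1 s) _)))
        where
        step : ∀ is js → list K (map (label K) (is ++ js)) ≡ append (map (label K) is) (list K (map (label K) js))
        step is js = trans (cong (list K) (map-++ (label K) is js)) (foldr-++ cons nil (map (label K) is) _)
      X : ℕ
      X = suc ⌊log₂ n ⌋ * (n * 36 + n * 15 + 12)
      bound≡ : 1 + (1 + (1 + 1 + (length (allFin n) * 8 + 3) + 0) + (X + 5)) +
               (1 + (1 + 1 + (length s * 18 + 3)) + (1 + (1 + 1 + (length s * 20 + 3)) +
               (1 + (7 + (1 + (7 + (1 + (7 + 1) + (length s * 116 + 3) + 0)) +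
                (length s * 116 + 3) + 0)) + (length s * 116 + 3))))
               ≡ steps n
      bound≡ = trans (collect X (length (allFin n)) (length s))
        (trans (cong₂ (λ k l → X + (k * 8 + l * 386) + 58) n-jobs
          (trans (↭-length (sort-↭ (allFin n))) n-jobs)) (total X n))
        where
        n-jobs : length (allFin n) ≡ n
        n-jobs = length-tabulate id
        collect : ∀ X k l → 1 + (1 + (1 + 1 + (k * 8 + 3) + 0) + (X + 5)) +
               (1 + (1 + 1 + (l * 18 + 3)) + (1 + (1 + 1 + (l * 20 + 3)) +
               (1 + (7 + (1 + (7 + (1 + (7 + 1) + (l * 116 + 3) + 0)) + (l * 116 + 3) + 0)) + (l * 116 + 3))))
               ≡ X + (k * 8 + l * 386) + 58
        collect = solve-∀
        total : ∀ X n → X + (n * 8 + n * 386) + 58 ≡ X + n * 394 + 58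
        total = solve-∀

theorem13 : ∀ {c ℓ₁ ℓ₂} →
    ∃[ P ] ∃[ T ] SolvesInTime c ℓ₁ ℓ₂ P T × O (λ n → n * ⌊log₂ n ⌋) T
theorem13 = program , steps , solves , steps-O
  where
  solves : SolvesInTime _ _ _ program steps
  solves K n I = schedule , time , derivation , schedule-optimal , time≤
    where
    open InstanceProperties I
    open Evaluation K
    open _⊢_⇓_within_ (main⇓ I)
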